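{- Let $n\ge 2$, $c\in\mathbb{Z}_+^n$, and let $K=K(c)$ be the $A_n$-crystal with parameter $c$. Let $a\in\mathcal{B}(c)$, let $K^{\uparrow}[a]$ be the upper subcrystal of $K$ containing the principal vertex $\pi[a]$, let $h^{\uparrow}\in\mathbb{Z}^{n-1}$ be the coordinate of $\pi[a]$ in the principal lattice $\Pi^{\uparrow}[a]$ of $K^{\uparrow}[a]$, and let $\Delta=(\Delta_1,\ldots,\Delta_{n-1})$ be such that $p:=h^{\uparrow}+\Delta$ is a coordinate of a vertex $v$ of $\Pi^{\uparrow}[a]$ (so $\Delta$ is the deviation of $v$ from $\pi[a]$ in $\Pi^{\uparrow}[a]$). Let $\tilde K$ be the middle subcrystal of $K$ containing $v$, let $K^{\downarrow}[b]$ ($b\in\mathcal{B}(c)$) be the lower subcrystal of $K$ containing $\tilde K$, and let $\nabla=(\nabla_2,\ldots,\nabla_n)$ be the deviation, from the heart $\pi[b]$, of the unique vertex of $\tilde K$ lying in the principal lattice $\Pi^{\downarrow}[b]$ of $K^{\downarrow}[b]$. Then $$\nabla_i=-\Delta_{i-1},\qquad i=2,\ldots,n.$$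
   Context: An $A_n$-crystal is a (regular, finite, connected) crystal graph of type $A_n$: a directed graph whose edges are colored $1,\ldots,n$, equivalently the Kashiwara crystal graph of an irreducible integrable highest-weight $U_q(\mathfrak{sl}_{n+1})$-module, where an $i$-colored edge $(u,v)$ means $v=F_i(u)$ for the (partial, invertible) lowering operator $F_i$. Each monochromatic connected component of color $i$ is a directed path. Such a crystal has a unique source $s_K$ (zero indegree); for $c=(c_1,\dots,c_n)\in\mathbb{Z}_+^n$, $K(c)$ denotes the unique $A_n$-crystal in which the maximal $i$-colored path starting at the source has length $c_i$ for every $i$. A subcrystal with color set $I$ means a maximal connected subgraph whose edges have colors in $I$; with colors $\{i,\dots,j\}$ it is itself an $A$-crystal (relabel colors $i,\dots,j$ as $1,\dots,j-i+1$), with its own parameter. Principal lattice: let $\mathcal{B}(c)=\{a\in\mathbb{Z}^n:0\le a\le c\}$. For $1\le k\le n$ let $S_{n,k}=w_{n,k,n-k+1}\cdots w_{n,k,2}w_{n,k,1}$ with $w_{n,k,j}=F_jF_{j+1}\cdots F_{j+k-1}$ (operators applied right to left). The principal vertex at $a\in\mathcal{B}(c)$ is $\pi[a]=S_{n,n}^{a_n}S_{n,n-1}^{a_{n-1}}\cdots S_{n,1}^{a_1}(s_K)$ (all these operators are applicable), and $\Pi=\{\pi[a]:a\in\mathcal{B}(c)\}$, the vertices $\pi[a]$ being distinct. For an $A_{n-1}$-crystal the principal lattice is defined the same way with $n-1$ in place of $n$; for a crystal with colors $2,\ldots,n$, colors $2,\dots,n$ play the roles of $1,\dots,n-1$ and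 the coordinates are indexed $q=(q_2,\ldots,q_n)$, $q_i$ corresponding to the original index $i-1$. Upper subcrystals are the subcrystals of $K$ with colors $1,\ldots,n-1$; lower subcrystals are those with colors $2,\ldots,n$; middle subcrystals are those with colors $2,\ldots,n-1$. It is known that each upper (resp. lower) subcrystal contains exactly one principal vertex of $K$, called its heart; $K^{\uparrow}[a]$ (resp. $K^{\downarrow}[b]$) denotes the upper (resp. lower) subcrystal containing $\pi[a]$ (resp. $\pi[b]$). $K^{\uparrow}[a]\cong K(c^{\uparrow})$ with $c^{\uparrow}_i=c_i-a_i+a_{i+1}$, and the coordinate of $\pi[a]$ in $\Pi^{\uparrow}[a]$ is $h^{\uparrow}=(a_2,\ldots,a_n)$; $K^{\downarrow}[b]$ has parameter $c^{\downarrow}_i=c_i-b_i+b_{i-1}$ ($i=2,\dots,n$), and the coordinate of $\pi[b]$ in $\Pi^{\downarrow}[b]$ is $h^{\downarrow}=(b_1,\ldots,b_{n-1})$ indexed as $h^{\downarrow}_i=b_{i-1}$, $i=2,\dots,n$. Each middle subcrystal is a lower subcrystal of some upper subcrystal and an upper subcrystal of some lower subcrystal, hence contains exactly one vertex of the principal lattice of each. The deviation of a vertex of $\Pi^{\uparrow}[a]$ with coordinate $p$ is $p-h^{\uparrow}$; the deviation of a vertex of $\Pi^{\downarrow}[b]$ with coordinate $q$ is $q-h^{\downarrow}$. -}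

module Defs where

open import Data.Nat using (ℕ; zero; suc; _+_; _∸_; _≤_; _≟_)
open import Data.List using (List; []; _∷_; _++_; map; concatMap; reverse; upTo; replicate; concat)
open import Data.Maybe using (Maybe; just; nothing; _>>=_)
import Data.Maybe as M
open import Data.Product using (Σ; ∃; _×_; _,_)
open import Relation.Nullary using (¬_; yes; no)
open import Relation.Binary.PropositionalEquality using (_≡_)

-- Concrete model of A_n-crystals: the crystal of words.
-- A vertex is a word over the letters 1,…,n+1 (B(□)^{⊗N}).
-- Colour i acts on letters i and i+1 by the bracket (signature) rule:
-- each letter i+1 is an opening bracket "(", each letter i a closing
-- bracket ")"; matched pairs "( … )" are cancelled; F_i turns the
-- rightmost unmatched letter i into i+1 (undefined if there is none).

Word : Set
Word = List ℕ

-- k = number of currently open (unmatched so far) letters i+1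
Fgo : ℕ → ℕ → Word → Maybe Word
Fgo i k [] = nothing
Fgo i k (x ∷ xs) with x ≟ suc i
... | yes _ = M.map (x ∷_) (Fgo i (suc k) xs)
... | no _ with x ≟ i
...   | no _ = M.map (x ∷_) (Fgo i k xs)
...   | yes _ with k
...     | suc k' = M.map (x ∷_) (Fgo i k' xs)
...     | zero with Fgo i zero xs
...       | just ys = just (x ∷ ys)
...       | nothing = just (suc i ∷ xs)

F : ℕ → Word → Maybe Word
F i w = Fgo i zero w

data Edge (I : ℕ → Set) : Word → Word → Set where
  edge : ∀ {i u v} → I i → F i u ≡ just v → Edge I u v

-- u and v lie in the same subcrystal with colour set I
-- (connected by an undirected path of I-coloured edges)
data Conn (I : ℕ → Set) : Word → Word → Set where
  here : ∀ {u} → Conn I u u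
  fwd  : ∀ {u v w} → Edge I u v → Conn I v w → Conn I u w
  bwd  : ∀ {u v w} → Edge I v u → Conn I v w → Conn I u w

Colours : ℕ → ℕ → ℕ → Set
Colours lo hi i = lo ≤ i × i ≤ hi

IsSource : (ℕ → Set) → Word → Word → Set
IsSource I x s = Conn I x s × (∀ u i → I i → ¬ (F i u ≡ just s))

iterM : ℕ → (Word → Maybe Word) → Word → Maybe Word
iterM zero f w = just w
iterM (suc k) f w = iterM k f w >>= f

PathLen : ℕ → Word → ℕ → Set
PathLen i s L = (∃ λ y → iterM L (F i) s ≡ just y) × iterM (suc L) (F i) s ≡ nothing

run : List ℕ → Word → Maybe Word
run [] w = just w
run (i ∷ is) w = F i w >>= run is

-- Principal lattice of an A_m-crystal whose colours are o+1,…,o+m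
-- (colour o+r plays the role of r).
-- w_{m,k,j} = F_{o+j} F_{o+j+1} ⋯ F_{o+j+k-1}  (rightmost applied first)
wList : ℕ → ℕ → ℕ → List ℕ
wList o k j = reverse (map (λ t → o + j + t) (upTo k))

SList : ℕ → ℕ → ℕ → List ℕ
SList o m k = concatMap (wList o k) (map suc (upTo (suc (m ∸ k))))

S : ℕ → ℕ → ℕ → Word → Maybe Word
S o m k = run (SList o m k)

-- coordinates x are indexed by o+1,…,o+m (coordinate x (o+k) is the
-- exponent of S_{m,k}); prUpTo applies S_{m,1}^{x(o+1)} first, …, S_{m,k}^{x(o+k)} last
prUpTo : ℕ → ℕ → (ℕ → ℕ) → ℕ → Word → Maybe Word
prUpTo o m x zero s = just s
prUpTo o m x (suc k) s = prUpTo o m x k s >>= iterM (x (o + suc k)) (S o m (suc k))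

principal : ℕ → ℕ → (ℕ → ℕ) → Word → Maybe Word
principal o m x s = prUpTo o m x m s

InBox : ℕ → ℕ → (ℕ → ℕ) → (ℕ → ℕ) → Set
InBox lo hi c x = ∀ i → lo ≤ i → i ≤ hi → x i ≤ c i

IsParam : ℕ → ℕ → Word → (ℕ → ℕ) → Set
IsParam o m s c' = ∀ i → Colours (suc o) (o + m) i → PathLen i s (c' i)

-- The source of K(c): the highest weight word
--   (column 1)^{c_1} (column 2)^{c_2} ⋯ (column n)^{c_n},
-- column k read as the decreasing word k (k-1) ⋯ 1.
-- It has weight λ with λ_k - λ_{k+1} = c_k; K(c) is its connected component.
column : ℕ → Word
column k = reverse (map suc (upTo k))

srcK : ℕ → (ℕ → ℕ) → Word
srcK n c = concatMap (λ k → concat (replicate (c k) (column k))) (map suc (upTo n))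

{-# OPTIONS --safe #-}
module Submission where

-- A middle component has a single source, hence well-defined parameters. For the component
-- of the vertex of Π↑[a] with coordinate p they are c↑ᵢ - pᵢ + pᵢ₋₁, for that of the vertex of
-- Π↓[b] with coordinate q they are c↓ᵢ - qᵢ + qᵢ₊₁, and for both hearts they equal cᵢ; so
-- Δᵢ₋₁ + ∇ᵢ does not depend on i. Counting the letters 1 and n + 1, which the middle colours
-- do not touch, shows that these numbers add up to 0.
--
-- That a component has a unique source follows by raising along a reduced word of the
-- longest permutation: the maximal raising operators satisfy the braid relations. The
-- signatures met on the way determine the vertex up to isomorphism of components, so the
-- source may be replaced by a convenient product X Y of columns on which the principal
-- operators leave X fixed and turn each column of Y into the lowest one.

open import Defs
open import Data.Bool using (if_then_else_)
open import Data.List using (List; []; _∷_; _++_; _∷ʳ_; map; concat; replicate; concatMap; upTo; applyUpTo; reverse; applyDownFrom)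
open import Data.List.Properties
open import Data.List.Relation.Unary.All as All using (All; []; _∷_)
open import Data.List.Relation.Unary.All.Properties using (++⁺)
open import Data.Maybe using (Maybe; just; nothing; _>>=_)
import Data.Maybe as M
open import Data.Maybe.Properties using (just-injective)
open import Data.Nat
open import Data.Nat.Properties
open import Algebra.Properties.CommutativeSemigroup +-commutativeSemigroup using (interchange; x∙yz≈y∙xz)
open import Data.Nat.Tactic.RingSolver using (solve-∀)
open import Data.Product using (∃; ∃₂; _×_; _,_; proj₁; proj₂)
open import Data.Sum using (inj₁; inj₂)
open import Relation.Binary using (tri<; tri≈; tri>)
open import Relation.Nullary using (¬_; yes; no; contradiction)
open import Relation.Binary.PropositionalEquality hiding (J)

-- Each `top i` reads a word from right to left with the pair (φ , ε) as its whole memory. The braid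
-- relations therefore need no crystal axioms: two cascades of raisings are fed the same letters and
-- their states compared. Braid moves rewrite a reduced word of the longest permutation in three
-- useful ways: with any colour in front, which transports F_i; with any colour at the end, which
-- reads off a parameter of the source; with the longest word of fewer colours as a prefix, which
-- restricts to upper, lower and middle subcrystals. Sources of middle components are not found by
-- raising. A product of columns is proposed as the source and lowered by middle colours to the
-- vertex in question; constancy of the climb on components does the rest. In such a source a column
-- contributes to colour i when i is its largest letter among those the middle colours see. The
-- index shifts come from visibility: sliding a column to its lowest position trades a letter 1 for
-- a visible letter in an upper crystal, and a visible letter for n + 1 in a lower one; in K both
-- happen and the shifts cancel.

Sig : Set
Sig = ℕ × ℕ

-- One move of a right-to-left reading: with (k , e) the numbers of unmatched
-- letters i and suc i already read, an unmatched suc i is raised to i.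
data Step (i : ℕ) : ℕ → Sig → ℕ → Sig → Set where
  close : ∀ {k e} → Step i i (k , e) i (suc k , e)
  match : ∀ {k e} → Step i (suc i) (suc k , e) (suc i) (k , e)
  raise : ∀ {e} → Step i (suc i) (0 , e) i (0 , suc e)
  skip  : ∀ {x s} → x ≢ i → x ≢ suc i → Step i x s x s

step : ∀ i x s → ∃₂ (Step i x s)
step i x s with x ≟ i | x ≟ suc i
step i x s           | yes refl | _        = _ , _ , close
step i x (zero , e)  | no _     | yes refl = _ , _ , raise
step i x (suc k , e) | no _     | yes refl = _ , _ , match
step i x s           | no x≢i   | no x≢i⁺  = _ , _ , skip x≢i x≢i⁺

step-det : ∀ {i x s y z s′ s″} → Step i x s y s′ → Step i x s z s″ → y ≡ z × s′ ≡ s″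
step-det close      close      = refl , refl
step-det match      match      = refl , refl
step-det raise      raise      = refl , refl
step-det (skip _ _) (skip _ _) = refl , refl
step-det close      (skip p _) = contradiction refl p
step-det match      (skip _ p) = contradiction refl p
step-det raise      (skip _ p) = contradiction refl p
step-det (skip p _) close      = contradiction refl p
step-det (skip _ p) match      = contradiction refl p
step-det (skip _ p) raise      = contradiction refl p

-- sig i w = (φᵢ(w) , εᵢ(w)), and top i w is the start of the i-coloured path through w.
sig : ℕ → Word → Sig
sig i []       = 0 , 0
sig i (x ∷ xs) = proj₁ (proj₂ (step i x (sig i xs)))

top : ℕ → Word → Word
top i []       = []
top i (x ∷ xs) = proj₁ (step i x (sig i xs)) ∷ top i xs

φ ε : ℕ → Word → ℕ
φ i w = proj₁ (sig i w)
ε i w = proj₂ (sig i w)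

sig-∷ : ∀ i {x} xs {y s s′} → sig i xs ≡ s → Step i x s y s′ → sig i (x ∷ xs) ≡ s′
sig-∷ i {x} xs refl st = proj₂ (step-det (proj₂ (proj₂ (step i x _))) st)

top-∷ : ∀ i {x} xs {y s s′} → sig i xs ≡ s → Step i x s y s′ → top i (x ∷ xs) ≡ y ∷ top i xs
top-∷ i {x} xs refl st = cong (_∷ top i xs) (proj₁ (step-det (proj₂ (proj₂ (step i x _))) st))

sig-top : ∀ i w → sig i (top i w) ≡ (φ i w + ε i w , 0)
sig-top i []       = refl
sig-top i (x ∷ xs) with sig i xs | sig-top i xs
... | s | ih with step i x s
... | _ , _ , close      = sig-∷ i (top i xs) ih close
... | _ , _ , match      = sig-∷ i (top i xs) ih match
... | _ , _ , raise      = sig-∷ i (top i xs) ih close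
... | _ , _ , skip p q   = sig-∷ i (top i xs) ih (skip p q)

top-source : ∀ i w → ε i w ≡ 0 → top i w ≡ w
top-source i []       _ = refl
top-source i (x ∷ xs) h with sig i xs in eq
... | s with step i x s
... | _ , _ , close      = cong (x ∷_) (top-source i xs (trans (cong proj₂ eq) h))
... | _ , _ , match      = cong (x ∷_) (top-source i xs (trans (cong proj₂ eq) h))
... | _ , _ , skip p q   = cong (x ∷_) (top-source i xs (trans (cong proj₂ eq) h))

-- Without an unmatched `suc i` in `u`, nothing in `u` pairs with the unmatched letters `i` of `v`.
sig-++-source : ∀ i u v → ε i u ≡ 0 → sig i (u ++ v) ≡ (φ i u + φ i v , ε i v)
sig-++-source i []       v _ = refl
sig-++-source i (x ∷ xs) v h with sig i xs | sig-++-source i xs v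
... | s | ih with step i x s
... | _ , _ , close      = sig-∷ i (xs ++ v) (ih h) close
... | _ , _ , match      = sig-∷ i (xs ++ v) (ih h) match
... | _ , _ , skip p q   = sig-∷ i (xs ++ v) (ih h) (skip p q)

sig-++-sink : ∀ i u v → φ i v ≡ 0 → sig i (u ++ v) ≡ (φ i u , ε i u + ε i v)
sig-++-sink i []       v h = cong (_, ε i v) h
sig-++-sink i (x ∷ xs) v h with sig i xs | sig-++-sink i xs v h
... | s | ih with step i x s
... | _ , _ , close      = sig-∷ i (xs ++ v) ih close
... | _ , _ , match      = sig-∷ i (xs ++ v) ih match
... | _ , _ , raise      = sig-∷ i (xs ++ v) ih raise
... | _ , _ , skip p q   = sig-∷ i (xs ++ v) ih (skip p q)

-- Lowering operators and signatures

Fgo-open : ∀ i k xs → Fgo i k (suc i ∷ xs) ≡ M.map (suc i ∷_) (Fgo i (suc k) xs)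
Fgo-open i k xs with suc i ≟ suc i
... | yes _ = refl
... | no p  = contradiction refl p

Fgo-match : ∀ i k xs → Fgo i (suc k) (i ∷ xs) ≡ M.map (i ∷_) (Fgo i k xs)
Fgo-match i k xs with i ≟ suc i
... | no _ with i ≟ i
... | yes _ = refl
... | no p  = contradiction refl p

Fgo-close : ∀ i {xs ys} → Fgo i 0 xs ≡ just ys → Fgo i 0 (i ∷ xs) ≡ just (i ∷ ys)
Fgo-close i {xs} h with i ≟ suc i
... | no _ with i ≟ i
... | no p  = contradiction refl p
... | yes _ with Fgo i 0 xs | h
... | just _ | refl = refl

Fgo-lower : ∀ i {xs} → Fgo i 0 xs ≡ nothing → Fgo i 0 (i ∷ xs) ≡ just (suc i ∷ xs)
Fgo-lower i {xs} h with i ≟ suc i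
... | no _ with i ≟ i
... | no p  = contradiction refl p
... | yes _ with Fgo i 0 xs | h
... | nothing | refl = refl

Fgo-skip : ∀ i k {x} xs → x ≢ i → x ≢ suc i → Fgo i k (x ∷ xs) ≡ M.map (x ∷_) (Fgo i k xs)
Fgo-skip i k {x} xs p q with x ≟ suc i
... | yes r = contradiction r q
... | no _ with x ≟ i
... | yes r = contradiction r p
... | no _  = refl

data Kind (i : ℕ) : ℕ → Set where
  low   : Kind i i
  high  : Kind i (suc i)
  other : ∀ {x} → x ≢ i → x ≢ suc i → Kind i x

kind : ∀ i x → Kind i x
kind i x with x ≟ i | x ≟ suc i
... | yes refl | _        = low
... | no _     | yes refl = high
... | no p     | no q     = other p q

-- The `k` brackets pending from the left absorb `k` of the φ unmatched letters `i`, so a letter is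
-- left to lower exactly when k < φ. Equality of the tops is recorded because it makes climbs
-- constant along edges.
data Lowered (i k : ℕ) (u : Word) : Maybe Word → Set where
  none : φ i u ≤ k → Lowered i k u nothing
  some : ∀ {v m e} → k ≤ m → sig i u ≡ (suc m , e) → sig i v ≡ (m , suc e) → top i u ≡ top i v →
         Lowered i k u (just v)

∷-top : ∀ i {x y} xs ys {s s′ t t′} → sig i xs ≡ s → sig i ys ≡ t →
        Step i x s y s′ → Step i x t y t′ → top i xs ≡ top i ys → top i (x ∷ xs) ≡ top i (x ∷ ys)
∷-top i xs ys p q st st′ h = trans (top-∷ i xs p st) (trans (cong (_ ∷_) h) (sym (top-∷ i ys q st′)))

Fgo-lowers : ∀ i k u → Lowered i k u (Fgo i k u)
Fgo-lowers i k [] = none z≤n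
Fgo-lowers i k (x ∷ xs) with kind i x
Fgo-lowers i k (.(suc i) ∷ xs) | high
  rewrite Fgo-open i k xs with Fgo i (suc k) xs | Fgo-lowers i (suc k) xs
... | just ys | some (s≤s k≤m) p q r = some k≤m (sig-∷ i xs p match) (sig-∷ i ys q match)
    (∷-top i xs ys p q match match r)
... | nothing | none h with sig i xs in eq
... | zero  , _ = none (≤-trans (≤-reflexive (cong proj₁ (sig-∷ i xs eq raise))) z≤n)
... | suc _ , _ = none (≤-trans (≤-reflexive (cong proj₁ (sig-∷ i xs eq match))) (s≤s⁻¹ h))
Fgo-lowers i k (x ∷ xs) | other x≢i x≢i⁺
  rewrite Fgo-skip i k xs x≢i x≢i⁺ with Fgo i k xs | Fgo-lowers i k xs
... | just ys | some k≤m p q r = some k≤m (sig-∷ i xs p st) (sig-∷ i ys q st) (∷-top i xs ys p q st st r)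
  where
    st : ∀ {s} → Step i x s x s
    st = skip x≢i x≢i⁺
... | nothing | none h = none (≤-trans (≤-reflexive (cong proj₁ (sig-∷ i xs refl (skip x≢i x≢i⁺)))) h)
Fgo-lowers i (suc k) (.i ∷ xs) | low
  rewrite Fgo-match i k xs with Fgo i k xs | Fgo-lowers i k xs
... | just ys | some k≤m p q r = some (s≤s k≤m) (sig-∷ i xs p close) (sig-∷ i ys q close)
    (∷-top i xs ys p q close close r)
... | nothing | none h = none (≤-trans (≤-reflexive (cong proj₁ (sig-∷ i xs refl close))) (s≤s h))
Fgo-lowers i zero (.i ∷ xs) | low with Fgo i 0 xs in eq | Fgo-lowers i 0 xs
... | just ys | some k≤m p q r = subst (Lowered i 0 (i ∷ xs)) (sym (Fgo-close i eq))
  (some z≤n (sig-∷ i xs p close) (sig-∷ i ys q close) (∷-top i xs ys p q close close r))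
... | nothing | none h = subst (Lowered i 0 (i ∷ xs)) (sym (Fgo-lower i eq))
  (some z≤n (sig-∷ i xs p close) (sig-∷ i xs p raise) (trans (top-∷ i xs p close) (sym (top-∷ i xs p raise))))
  where
    p : sig i xs ≡ (0 , ε i xs)
    p = cong (_, ε i xs) (n≤0⇒n≡0 h)

F-sig : ∀ {i u v} → F i u ≡ just v → ∃₂ λ m e → sig i u ≡ (suc m , e) × sig i v ≡ (m , suc e) × top i u ≡ top i v
F-sig {i} {u} h with F i u | Fgo-lowers i 0 u
F-sig refl | _ | some _ p q r = _ , _ , p , q , r

F-defined : ∀ {i u m e} → sig i u ≡ (suc m , e) → ∃ λ v → F i u ≡ just v
F-defined {i} {u} h with F i u | Fgo-lowers i 0 u
... | just v  | _ = v , refl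
... | nothing | none φ≤0 with () ← ≤-trans (≤-reflexive (sym (cong proj₁ h))) φ≤0

F-undefined : ∀ {i u} → F i u ≡ nothing → φ i u ≡ 0
F-undefined {i} {u} h with F i u | Fgo-lowers i 0 u
... | nothing | none φ≤0 = n≤0⇒n≡0 φ≤0

Fgo-undefined : ∀ {i k u} → φ i u ≤ k → Fgo i k u ≡ nothing
Fgo-undefined {i} {k} {u} h with Fgo i k u | Fgo-lowers i k u
... | nothing | _ = refl
... | just _  | some k≤m p _ _ = contradiction (≤-trans (≤-reflexive (sym (cong proj₁ p))) h) (≤⇒≯ k≤m)

-- All unmatched letters of `U` are `i` and all those of `V` are `suc i`, so the displayed `i` is
-- the rightmost unmatched one. In `go` the bound k ≤ φ ensures that every pending bracket is closed
-- before the end of `U`.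
F-at : ∀ i U V → ε i U ≡ 0 → φ i V ≡ 0 → F i (U ++ i ∷ V) ≡ just (U ++ suc i ∷ V)
F-at i U V εU φV = go U 0 εU z≤n
  where
    go : ∀ U k → ε i U ≡ 0 → k ≤ φ i U → Fgo i k (U ++ i ∷ V) ≡ just (U ++ suc i ∷ V)
    go [] zero _ _ = Fgo-lower i (Fgo-undefined {u = V} (≤-reflexive φV))
    go (x ∷ xs) k h k≤ with sig i xs in eq
    ... | s with step i x s
    go (x ∷ xs) zero h k≤ | s | _ , _ , close =
      Fgo-close i (go xs 0 (trans (cong proj₂ eq) h) z≤n)
    go (x ∷ xs) (suc k) h k≤ | s | _ , _ , close =
      trans (Fgo-match i k _) (cong (M.map (i ∷_))
          (go xs k (trans (cong proj₂ eq) h) (≤-trans (s≤s⁻¹ k≤) (≤-reflexive (sym (cong proj₁ eq))))))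
    go (x ∷ xs) k h k≤ | s | _ , _ , match =
      trans (Fgo-open i k _) (cong (M.map (suc i ∷_))
          (go xs (suc k) (trans (cong proj₂ eq) h) (≤-trans (s≤s k≤) (≤-reflexive (sym (cong proj₁ eq))))))
    go (x ∷ xs) k h k≤ | s | _ , _ , skip p q =
      trans (Fgo-skip i k _ p q) (cong (M.map (x ∷_))
          (go xs k (trans (cong proj₂ eq) h) (≤-trans k≤ (≤-reflexive (sym (cong proj₁ eq))))))

-- The preimage raises the leftmost unmatched `suc i`; by k ≤ φ no bracket is pending there. This is
-- how the absence of incoming edges forces ε = 0.
Fgo-preimage : ∀ i k w → 0 < ε i w → k ≤ φ i w → ∃ λ u → Fgo i k u ≡ just w
Fgo-preimage i k (x ∷ xs) ε>0 k≤ with sig i xs in eq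
... | s with step i x s
Fgo-preimage i zero (x ∷ xs) ε>0 k≤ | s | _ , _ , close =
  let u , h = Fgo-preimage i 0 xs (subst (0 <_) (sym (cong proj₂ eq)) ε>0) z≤n in i ∷ u , Fgo-close i h
Fgo-preimage i (suc k) (x ∷ xs) ε>0 k≤ | s | _ , _ , close =
  let u , h = Fgo-preimage i k xs (subst (0 <_) (sym (cong proj₂ eq)) ε>0)
        (≤-trans (s≤s⁻¹ k≤) (≤-reflexive (sym (cong proj₁ eq))))
  in i ∷ u , trans (Fgo-match i k u) (cong (M.map (i ∷_)) h)
Fgo-preimage i k (x ∷ xs) ε>0 k≤ | s | _ , _ , match =
  let u , h = Fgo-preimage i (suc k) xs (subst (0 <_) (sym (cong proj₂ eq)) ε>0)
        (≤-trans (s≤s k≤) (≤-reflexive (sym (cong proj₁ eq))))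
  in suc i ∷ u , trans (Fgo-open i k u) (cong (M.map (suc i ∷_)) h)
Fgo-preimage i zero (x ∷ xs) ε>0 k≤ | s | _ , _ , raise =
  i ∷ xs , Fgo-lower i (Fgo-undefined {u = xs} (≤-reflexive (cong proj₁ eq)))
Fgo-preimage i k (x ∷ xs) ε>0 k≤ | s | _ , _ , skip p q =
  let u , h = Fgo-preimage i k xs (subst (0 <_) (sym (cong proj₂ eq)) ε>0)
        (≤-trans k≤ (≤-reflexive (sym (cong proj₁ eq))))
  in x ∷ u , trans (Fgo-skip i k u p q) (cong (M.map (x ∷_)) h)

-- Braid relations

-- How the signatures met along i, suc i, i determine those met along suc i, i, suc i.
-- The φ-parts satisfy k₂ = l₁ ⊓ l₃, l₂ = k₁ ⊓ k₃, k₁ + k₂ = l₂ + l₃, k₂ + k₃ = l₁ + l₂;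
-- the constructors split on the sign of k₁ - k₃.
data Braided : (a₁ a₂ a₃ b₁ b₂ b₃ : Sig) → Set where
  left  : ∀ {m t d p s k₁ e₂ f₁ f₂ l₃} →
          k₁ ≡ m + d → e₂ ≡ p + (d + s) → f₁ ≡ d + s → f₂ ≡ p + s → l₃ ≡ t + d →
          Braided (k₁ , p) (t , e₂) (m , s) (t , f₁) (m , f₂) (l₃ , p)
  right : ∀ {m t d p s k₃ e₁ e₂ l₁ f₂} →
          k₃ ≡ m + d → e₁ ≡ d + p → e₂ ≡ s + p → l₁ ≡ t + d → f₂ ≡ s + (d + p) →
          Braided (m , e₁) (t , e₂) (k₃ , s) (l₁ , s) (m , f₂) (t , p)

Braided-sym : ∀ {a₁ a₂ a₃ b₁ b₂ b₃} → Braided a₁ a₂ a₃ b₁ b₂ b₃ → Braided b₁ b₂ b₃ a₁ a₂ a₃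
Braided-sym (left  p q r s t) = right t r s p q
Braided-sym (right p q r s t) = left s t q r p

-- One triple of a `Braided` pair determines the other. Of the truncated differences `k₁ ∸ k₃` and
-- `k₃ ∸ k₁`, one is the `d` of the constructor and the other is 0.
braid : Sig × Sig × Sig → Sig × Sig × Sig
braid ((k₁ , e₁) , (k₂ , e₂) , (k₃ , e₃)) =
  (k₂ + (k₃ ∸ k₁) , e₃ + (k₁ ∸ k₃)) , (k₁ ⊓ k₃ , e₁ + e₃) , (k₂ + (k₁ ∸ k₃) , e₁ ∸ (k₃ ∸ k₁))

Braided⇒braid : ∀ {a₁ a₂ a₃ b₁ b₂ b₃} → Braided a₁ a₂ a₃ b₁ b₂ b₃ → (b₁ , b₂ , b₃) ≡ braid (a₁ , a₂ , a₃)
Braided⇒braid (left {m} {t} {d} {p} {s} refl refl refl refl refl)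
  rewrite m+n∸m≡n m d | m≤n⇒m∸n≡0 (m≤m+n m d) | m≥n⇒m⊓n≡n (m≤m+n m d) | +-identityʳ t | +-comm d s = refl
Braided⇒braid (right {m} {t} {d} {p} {s} refl refl refl refl refl)
  rewrite m+n∸m≡n m d | m≤n⇒m∸n≡0 (m≤m+n m d) | m≤n⇒m⊓n≡m (m≤m+n m d) | +-identityʳ t | +-identityʳ s
        | m+n∸m≡n d p | +-comm s (d + p) = refl

out-≡ : ∀ {i x s y s′} → Step i x s y s′ → proj₁ (step i x s) ≡ y
out-≡ {i} {x} {s} = λ st → proj₁ (step-det (proj₂ (proj₂ (step i x s))) st)

next-≡ : ∀ {i x s y s′} → Step i x s y s′ → proj₁ (proj₂ (step i x s)) ≡ s′
next-≡ {i} {x} {s} = λ st → proj₂ (step-det (proj₂ (proj₂ (step i x s))) st)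

-- One letter `x` sent through both three-stage cascades: both emit the same `y`, and the new states
-- are again `Braided`. Thus `Braided` is an invariant of reading, and induction on the word gives
-- the braid relation.
data Advance (i x : ℕ) (a₁ a₂ a₃ b₁ b₂ b₃ : Sig) : Set where
  advance : ∀ {y₁ y₂ z₁ z₂ y a₁′ a₂′ a₃′ b₁′ b₂′ b₃′} →
            Step i x a₁ y₁ a₁′ → Step (suc i) y₁ a₂ y₂ a₂′ → Step i y₂ a₃ y a₃′ →
            Step (suc i) x b₁ z₁ b₁′ → Step i z₁ b₂ z₂ b₂′ → Step (suc i) z₂ b₃ y b₃′ →
            Braided a₁′ a₂′ a₃′ b₁′ b₂′ b₃′ → Advance i x a₁ a₂ a₃ b₁ b₂ b₃

skip-low : ∀ {i s} → Step (suc i) i s i s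
skip-low = skip (λ ()) (λ ())

skip-high : ∀ {i s} → Step i (suc (suc i)) s (suc (suc i)) s
skip-high = skip (λ ()) (λ ())

advance-close : ∀ {i a₁ a₂ a₃ b₁ b₂ b₃} → Braided a₁ a₂ a₃ b₁ b₂ b₃ → Advance i i a₁ a₂ a₃ b₁ b₂ b₃
advance-close (left refl q r s t)  = advance close skip-low close skip-low close skip-low (left refl q r s t)
advance-close (right refl q r s t) = advance close skip-low close skip-low close skip-low (right refl q r s t)

advance-mid : ∀ {i a₁ a₂ a₃ b₁ b₂ b₃} → Braided a₁ a₂ a₃ b₁ b₂ b₃ → Advance i (suc i) a₁ a₂ a₃ b₁ b₂ b₃
advance-mid (left {suc m} refl q r s refl) =
  advance match close match close match close (left refl q r s refl)
advance-mid (left {zero} {t} {suc d} {p} {s} refl refl refl refl refl) =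
  advance match close raise close raise skip-low
    (left refl (cong (p +_) (sym (+-suc d s))) (sym (+-suc d s)) (sym (+-suc p s)) (+-suc t d))
-- On the wall k₁ = k₃ = 0 the letter increases only k₃, so the state crosses to `right`;
-- `advance-open` has the opposite crossing.
advance-mid (left {zero} {t} {zero} {p} {s} refl refl refl refl refl) rewrite +-identityʳ t =
  advance raise skip-low close close raise skip-low
    (right refl refl (+-comm p s) (+-comm 1 t) (trans (cong suc (+-comm p s)) (sym (+-suc s p))))
advance-mid (right {suc m} refl q r refl t) =
  advance match close match close match close (right refl q r refl t)
advance-mid (right {zero} {t} {d} {p} {s} refl refl refl refl refl) =
  advance raise skip-low close close raise skip-low
    (right refl refl refl (sym (+-suc t d)) (sym (+-suc s (d + p))))

advance-open : ∀ {i a₁ a₂ a₃ b₁ b₂ b₃} → Braided a₁ a₂ a₃ b₁ b₂ b₃ → Advance i (suc (suc i)) a₁ a₂ a₃ b₁ b₂ b₃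
advance-open (left {t = suc t} p q r s refl) =
  advance skip-high match skip-high match skip-high match (left p q r s refl)
advance-open (left {suc m} {zero} {d} {p} {s} refl refl refl refl refl) =
  advance skip-high raise match raise match close
    (left (sym (+-suc m d)) (sym (+-suc p (d + s))) refl refl refl)
advance-open (left {zero} {zero} {d} {p} {s} refl refl refl refl refl) =
  advance skip-high raise raise raise raise skip-low
    (left refl (trans (sym (+-suc p (d + s))) (cong (p +_) (sym (+-suc d s)))) (sym (+-suc d s))
        (sym (+-suc p s)) refl)
advance-open (right {t = suc t} p q r refl s) =
  advance skip-high match skip-high match skip-high match (right p q r refl s)
advance-open (right {suc m} {zero} {suc d} {p} {s} refl refl refl refl refl) =
  advance skip-high raise match match skip-high raise
    (right (+-suc m d) (sym (+-suc d p)) (sym (+-suc s p)) refl (cong (s +_) (sym (+-suc d p))))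
advance-open (right {suc m} {zero} {zero} {p} {s} refl refl refl refl refl) rewrite +-identityʳ m =
  advance skip-high raise match raise match close
    (left (+-comm 1 m) (+-comm (suc s) p) refl (+-comm s p) refl)
advance-open (right {zero} {zero} {suc d} {p} {s} refl refl refl refl refl) =
  advance skip-high raise match match skip-high raise
    (right refl (sym (+-suc d p)) (sym (+-suc s p)) refl (cong (s +_) (sym (+-suc d p))))
advance-open (right {zero} {zero} {zero} refl refl refl refl refl) =
  advance skip-high raise raise raise raise skip-low (right refl refl refl refl refl)

advance-any : ∀ i x {a₁ a₂ a₃ b₁ b₂ b₃} → Braided a₁ a₂ a₃ b₁ b₂ b₃ → Advance i x a₁ a₂ a₃ b₁ b₂ b₃
advance-any i x h with kind i x | x ≟ suc (suc i)
... | low       | _        = advance-close h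
... | high      | _        = advance-mid h
... | other _ _ | yes refl = advance-open h
... | other p q | no r     = advance (skip p q) (skip q r) (skip p q) (skip q r) (skip p q) (skip q r) h

braid-relation : ∀ i w →
  Braided (sig i w) (sig (suc i) (top i w)) (sig i (top (suc i) (top i w)))
          (sig (suc i) w) (sig i (top (suc i) w)) (sig (suc i) (top i (top (suc i) w))) ×
  top i (top (suc i) (top i w)) ≡ top (suc i) (top i (top (suc i) w))
braid-relation i [] = left {d = 0} refl refl refl refl refl , refl
braid-relation i (x ∷ xs) with braid-relation i xs
... | h , eq with advance-any i x h
... | advance {y₁} {y₂} {z₁} {z₂} s₁ s₂ s₃ t₁ t₂ t₃ h′
  rewrite out-≡ s₁ | next-≡ s₁ | out-≡ s₂ | next-≡ s₂ | out-≡ s₃ | next-≡ s₃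
        | out-≡ t₁ | next-≡ t₁ | out-≡ t₂ | next-≡ t₂ | out-≡ t₃ | next-≡ t₃
  = h′ , cong (_ ∷_) eq

data Far (i j : ℕ) : Set where
  far : i ≢ j → i ≢ suc j → suc i ≢ j → Far i j

Far-sym : ∀ {i j} → Far i j → Far j i
Far-sym (far p q r) = far (≢-sym p) (≢-sym r) (≢-sym q)

skip-out : ∀ {i j x y a b b′} → Far i j → Step j x b y b′ → x ≢ i → x ≢ suc i → Step i y a y a
skip-out _           close      s t = skip s t
skip-out _           match      s t = skip s t
skip-out (far p _ r) raise      _ _ = skip (≢-sym p) (≢-sym r)
skip-out _           (skip _ _) s t = skip s t

data Commuting (i j x : ℕ) (a b : Sig) : Set where
  commuting : ∀ {y z u a′ b′} → Step i x a y a′ → Step j y b u b′ → Step j x b z b′ → Step i z a u a′ →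
              Commuting i j x a b

commuting-any : ∀ {i j} x a b → Far i j → Commuting i j x a b
commuting-any {i} {j} x a b f@(far p q r) with step i x a | step j x b
... | _ , _ , skip s t | _ , _ , st       = commuting (skip s t) st st (skip-out f st s t)
... | _ , _ , st       | _ , _ , skip s t = commuting st (skip-out (Far-sym f) st s t) (skip s t) st
... | _ , _ , close | _ , _ , close = contradiction refl p
... | _ , _ , close | _ , _ , match = contradiction refl q
... | _ , _ , close | _ , _ , raise = contradiction refl q
... | _ , _ , match | _ , _ , close = contradiction refl r
... | _ , _ , match | _ , _ , match = contradiction refl p
... | _ , _ , match | _ , _ , raise = contradiction refl p
... | _ , _ , raise | _ , _ , close = contradiction refl r
... | _ , _ , raise | _ , _ , match = contradiction refl p
... | _ , _ , raise | _ , _ , raise = contradiction refl p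

far-commute : ∀ {i j} → Far i j → ∀ w →
  sig j (top i w) ≡ sig j w × sig i (top j w) ≡ sig i w × top j (top i w) ≡ top i (top j w)
far-commute f [] = refl , refl , refl
far-commute {i} {j} f (x ∷ xs) with far-commute f xs
... | p , q , r with commuting-any x (sig i xs) (sig j xs) f
... | commuting s₁ s₂ t₁ t₂
  rewrite p | q | out-≡ s₁ | next-≡ s₁ | out-≡ s₂ | next-≡ s₂ | out-≡ t₁ | next-≡ t₁ | out-≡ t₂ | next-≡ t₂
  = refl , refl , cong (_ ∷_) r

-- Climbs, traces and braid moves

climb : List ℕ → Word → Word
climb []      w = w
climb (i ∷ D) w = climb D (top i w)

trace : List ℕ → Word → List Sig
trace []      w = []
trace (i ∷ D) w = sig i w ∷ trace D (top i w)

infix 4 _~_ _⊢_≈_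

-- Braid moves only, with no cancellation of `i ∷ i`: maximal raising is idempotent, not an
-- involution.
data _~_ : List ℕ → List ℕ → Set where
  swap   : ∀ {i j D} → Far i j → i ∷ j ∷ D ~ j ∷ i ∷ D
  braid³ : ∀ {i D} → i ∷ suc i ∷ i ∷ D ~ suc i ∷ i ∷ suc i ∷ D
  prep   : ∀ {i D E} → D ~ E → i ∷ D ~ i ∷ E
  ~-refl : ∀ {D} → D ~ D
  ~-sym  : ∀ {D E} → D ~ E → E ~ D
  ~-trans : ∀ {D E G} → D ~ E → E ~ G → D ~ G

~-climb : ∀ {D E} → D ~ E → ∀ w → climb D w ≡ climb E w
~-climb (swap {D = D} f) w = cong (climb D) (proj₂ (proj₂ (far-commute f w)))
~-climb (braid³ {i} {D}) w = cong (climb D) (proj₂ (braid-relation i w))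
~-climb (prep h) w = ~-climb h _
~-climb ~-refl w = refl
~-climb (~-sym h) w = sym (~-climb h w)
~-climb (~-trans h h′) w = trans (~-climb h w) (~-climb h′ w)

∷-injective³ : ∀ {A : Set} {a b c a′ b′ c′ : A} {xs ys : List A} →
               _≡_ {A = List A} (a ∷ b ∷ c ∷ xs) (a′ ∷ b′ ∷ c′ ∷ ys) →
               (a , b , c) ≡ (a′ , b′ , c′) × xs ≡ ys
∷-injective³ refl = refl , refl

∷-cong³ : ∀ {A : Set} {a b c a′ b′ c′ : A} {xs ys : List A} → (a , b , c) ≡ (a′ , b′ , c′) → xs ≡ ys →
          _≡_ {A = List A} (a ∷ b ∷ c ∷ xs) (a′ ∷ b′ ∷ c′ ∷ ys)
∷-cong³ refl refl = refl

braided-transfer : ∀ {a₁ a₂ a₃ b₁ b₂ b₃ a₁′ a₂′ a₃′ b₁′ b₂′ b₃′} →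
  Braided a₁ a₂ a₃ b₁ b₂ b₃ → Braided a₁′ a₂′ a₃′ b₁′ b₂′ b₃′ →
  (a₁ , a₂ , a₃) ≡ (a₁′ , a₂′ , a₃′) → (b₁ , b₂ , b₃) ≡ (b₁′ , b₂′ , b₃′)
braided-transfer h h′ eq = trans (Braided⇒braid h) (trans (cong braid eq) (sym (Braided⇒braid h′)))

-- For D a reduced word of the longest permutation this says that sending u to v extends to
-- an isomorphism of their components.
_⊢_≈_ : List ℕ → Word → Word → Set
D ⊢ u ≈ v = trace D u ≡ trace D v

-- A move changes the signatures it touches by a function of them and leaves the climbed word, hence
-- the rest of the trace, alone. Both directions are proved together because `~-sym` exchanges them.
~-trace : ∀ {D E} → D ~ E → ∀ {u v} → (D ⊢ u ≈ v → E ⊢ u ≈ v) × (E ⊢ u ≈ v → D ⊢ u ≈ v)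
~-trace (swap f) = far-trace f , far-trace (Far-sym f)
  where
    far-trace : ∀ {i j D u v} → Far i j → i ∷ j ∷ D ⊢ u ≈ v → j ∷ i ∷ D ⊢ u ≈ v
    far-trace {i} {j} {D} {u} {v} f h with far-commute f u | far-commute f v
    ... | p , q , r | p′ , q′ , r′ rewrite p | q | p′ | q′ | r | r′ with h′ ← ∷-injective h
      = cong₂ _∷_ (proj₁ (∷-injective (proj₂ h′))) (cong₂ _∷_ (proj₁ h′) (proj₂ (∷-injective (proj₂ h′))))
~-trace (braid³ {i} {D}) {u} {v} = to , from
  where
    to : i ∷ suc i ∷ i ∷ D ⊢ u ≈ v → suc i ∷ i ∷ suc i ∷ D ⊢ u ≈ v
    to h with braid-relation i u | braid-relation i v | ∷-injective³ h
    ... | b , eq | b′ , eq′ | p , q =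
      ∷-cong³ (braided-transfer b b′ p) (trans (cong (trace D) (sym eq)) (trans q (cong (trace D) eq′)))
    from : suc i ∷ i ∷ suc i ∷ D ⊢ u ≈ v → i ∷ suc i ∷ i ∷ D ⊢ u ≈ v
    from h with braid-relation i u | braid-relation i v | ∷-injective³ h
    ... | b , eq | b′ , eq′ | p , q =
      ∷-cong³ (braided-transfer (Braided-sym b) (Braided-sym b′) p)
              (trans (cong (trace D) eq) (trans q (cong (trace D) (sym eq′))))
~-trace (prep h) =
  (λ eq → cong₂ _∷_ (proj₁ (∷-injective eq)) (proj₁ (~-trace h) (proj₂ (∷-injective eq)))) ,
  (λ eq → cong₂ _∷_ (proj₁ (∷-injective eq)) (proj₂ (~-trace h) (proj₂ (∷-injective eq))))
~-trace ~-refl = (λ h → h) , (λ h → h)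
~-trace (~-sym h) = proj₂ (~-trace h) , proj₁ (~-trace h)
~-trace (~-trans h h′) =
  (λ eq → proj₁ (~-trace h′) (proj₁ (~-trace h) eq)) , (λ eq → proj₂ (~-trace h) (proj₂ (~-trace h′) eq))

++-~ : ∀ {D E} G → D ~ E → D ++ G ~ E ++ G
++-~ G (swap f) = swap f
++-~ G braid³ = braid³
++-~ G (prep h) = prep (++-~ G h)
++-~ G ~-refl = ~-refl
++-~ G (~-sym h) = ~-sym (++-~ G h)
++-~ G (~-trans h h′) = ~-trans (++-~ G h) (++-~ G h′)

~-++ : ∀ G {D E} → D ~ E → G ++ D ~ G ++ E
~-++ []      h = h
~-++ (i ∷ G) h = prep (~-++ G h)

≡⇒~ : ∀ {D E} → D ≡ E → D ~ E
≡⇒~ refl = ~-refl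

-- Reduced words of the longest permutation

desc : ℕ → ℕ → List ℕ
desc l zero    = []
desc l (suc m) = m + l ∷ desc l m

asc : ℕ → ℕ → List ℕ
asc l zero    = []
asc l (suc m) = l ∷ asc (suc l) m

-- A reduced word of the longest permutation of the letters l , … , m + l.
longest : ℕ → ℕ → List ℕ
longest l zero    = []
longest l (suc m) = longest l m ++ desc l (suc m)

Range : ℕ → ℕ → ℕ → Set
Range l h i = l ≤ i × i < h

All-desc : ∀ l m → All (Range l (m + l)) (desc l m)
All-desc l zero    = []
All-desc l (suc m) = (m≤n+m l m , ≤-refl) ∷ All.map (λ (p , q) → p , m<n⇒m<1+n q) (All-desc l m)

All-asc : ∀ l m → All (Range l (m + l)) (asc l m)
All-asc l zero    = []
All-asc l (suc m) = (≤-refl , s≤s (m≤n+m l m)) ∷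
  All.map (λ (p , q) → <⇒≤ p , ≤-trans q (≤-reflexive (+-suc m l))) (All-asc (suc l) m)

All-longest : ∀ l m → All (Range l (m + l)) (longest l m)
All-longest l zero    = []
All-longest l (suc m) = ++⁺ (All.map (λ (p , q) → p , m<n⇒m<1+n q) (All-longest l m)) (All-desc l (suc m))

past : ∀ {i} D → All (Far i) D → i ∷ D ~ D ∷ʳ i
past []      []       = ~-refl
past (j ∷ D) (f ∷ fs) = ~-trans (swap f) (prep (past D fs))

-- The letter `i` commutes past everything above `suc i`; one braid move with `suc i` and `i` turns
-- it into `suc i`, which commutes past everything below `i`.
past-desc : ∀ l m {i} → Range l (m + l) i → i ∷ desc l (suc m) ~ desc l (suc m) ∷ʳ suc i
past-desc l zero    (l≤i , i<l) = contradiction l≤i (<⇒≱ i<l)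
past-desc l (suc m) {i} (l≤i , i<) with m≤n⇒m<n∨m≡n (s≤s⁻¹ i<)
... | inj₁ i<m+l = ~-trans (swap (far (<⇒≢ (m<n⇒m<1+n i<m+l)) (<⇒≢ (m<n⇒m<1+n (m<n⇒m<1+n i<m+l)))
    (<⇒≢ (s≤s i<m+l))))
                           (prep (past-desc l m (l≤i , i<m+l)))
... | inj₂ refl = ~-trans braid³ (prep (prep (past (desc l m) (All.map below (All-desc l m)))))
  where
    below : ∀ {j} → Range l (m + l) j → Far (suc (m + l)) j
    below (_ , j<) = far (≢-sym (<⇒≢ (m<n⇒m<1+n j<))) (≢-sym (<⇒≢ (s≤s j<)))
                         (≢-sym (<⇒≢ (m<n⇒m<1+n (m<n⇒m<1+n j<))))

past-desc* : ∀ l m {E} → All (Range l (m + l)) E → E ++ desc l (suc m) ~ desc l (suc m) ++ map suc E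
past-desc* l m []             = ≡⇒~ (sym (++-identityʳ _))
past-desc* l m (_∷_ {i} {E} r rs) = ~-trans (prep (past-desc* l m rs))
  (~-trans (++-~ (map suc E) (past-desc l m r)) (≡⇒~ (++-assoc (desc l (suc m)) (suc i ∷ []) (map suc E))))

map-suc-desc : ∀ l m → map suc (desc l m) ≡ desc (suc l) m
map-suc-desc l zero    = refl
map-suc-desc l (suc m) = cong₂ _∷_ (sym (+-suc m l)) (map-suc-desc l m)

map-suc-asc : ∀ l m → map suc (asc l m) ≡ asc (suc l) m
map-suc-asc l zero    = refl
map-suc-asc l (suc m) = cong (suc l ∷_) (map-suc-asc (suc l) m)

map-suc-longest : ∀ l m → map suc (longest l m) ≡ longest (suc l) m
map-suc-longest l zero    = refl
map-suc-longest l (suc m) =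
  trans (map-++ suc (longest l m) _) (cong₂ _++_ (map-suc-longest l m) (map-suc-desc l (suc m)))

desc-∷ʳ : ∀ l m → desc l (suc m) ≡ desc (suc l) m ∷ʳ l
desc-∷ʳ l zero    = refl
desc-∷ʳ l (suc m) = cong₂ _∷_ (sym (+-suc m l)) (desc-∷ʳ l m)

longest-desc : ∀ l m → longest l (suc m) ~ desc l (suc m) ++ longest (suc l) m
longest-desc l m = subst (λ E → longest l (suc m) ~ desc l (suc m) ++ E) (map-suc-longest l m)
  (past-desc* l m (All-longest l m))

-- Makes the longest word of the colours without `l` a prefix, as the one without the largest colour
-- is by definition. These two prefixes restrict traces to smaller colour sets.
longest-asc : ∀ l m → longest l (suc m) ~ longest (suc l) m ++ asc l (suc m)
longest-asc l zero    = ~-refl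
longest-asc l (suc m) = ~-trans (++-~ (desc l (2 + m)) (longest-asc l m)) (~-trans (≡⇒~ (++-assoc W _ _))
  (~-trans (~-++ W (past-desc* l (suc m) (All-asc l (suc m)))) (≡⇒~ tail)))
  where
    W : List ℕ
    W = longest (suc l) m
    tail : W ++ desc l (2 + m) ++ map suc (asc l (suc m)) ≡ longest (suc l) (suc m) ++ asc l (2 + m)
    tail = trans (cong₂ (λ D E → W ++ D ++ E) (desc-∷ʳ l (suc m)) (map-suc-asc l (suc m)))
      (trans (cong (W ++_) (++-assoc (desc (suc l) (suc m)) (l ∷ []) (asc (suc l) (suc m))))
             (sym (++-assoc W (desc (suc l) (suc m)) (asc l (2 + m)))))

longest-starts : ∀ l m {i} → Range l (m + l) i → ∃ λ D → longest l m ~ i ∷ D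
longest-starts l zero    (l≤i , i<l) = contradiction l≤i (<⇒≱ i<l)
longest-starts l (suc m) (l≤i , i<) with m≤n⇒m<n∨m≡n (s≤s⁻¹ i<)
... | inj₁ i<m+l = let D , h = longest-starts l m (l≤i , i<m+l) in D ++ desc l (suc m) , ++-~ _ h
... | inj₂ refl  = _ , longest-desc l m

longest-ends : ∀ l m {i} → Range l (m + l) i → ∃ λ D → longest l m ~ D ∷ʳ i
longest-ends l zero    (l≤i , i<l) = contradiction l≤i (<⇒≱ i<l)
longest-ends l (suc m) {i} (l≤i , i<) with m≤n⇒m<n∨m≡n l≤i
... | inj₁ l<i  =
  let D , h = longest-ends (suc l) m (l<i , ≤-trans i< (≤-reflexive (sym (+-suc m l))))
  in desc l (suc m) ++ D , ~-trans (longest-desc l m)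
       (~-trans (~-++ (desc l (suc m)) h) (≡⇒~ (sym (++-assoc (desc l (suc m)) D (i ∷ [])))))
... | inj₂ refl = longest l m ++ desc (suc l) m ,
  ≡⇒~ (trans (cong (longest l m ++_) (desc-∷ʳ l m)) (sym (++-assoc (longest l m) (desc (suc l) m) (l ∷ []))))

-- Components and their sources

-- With `i` brought to the front, the first raising already sends `u` and `v` to the same word.
F-starts : ∀ {l m i u v} → Range l (m + l) i → F i u ≡ just v →
           climb (longest l m) u ≡ climb (longest l m) v
F-starts {l} {m} {i} {u} {v} r h with longest-starts l m r | F-sig {u = u} h
... | D , eq | _ , _ , _ , _ , tops =
  trans (~-climb eq u) (trans (cong (climb D) tops) (sym (~-climb eq v)))

-- A source is its own climb (`climb-source`), so this contains the uniqueness of the source.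
Conn-climb : ∀ {l m I u v} → (∀ {i} → I i → Range l (m + l) i) → Conn I u v →
             climb (longest l m) u ≡ climb (longest l m) v
Conn-climb f here = refl
Conn-climb {l} {m} f (fwd (edge i∈I h) c) = trans (F-starts {l} {m} (f i∈I) h) (Conn-climb {l} {m} f c)
Conn-climb {l} {m} f (bwd (edge i∈I h) c) = trans (sym (F-starts {l} {m} (f i∈I) h)) (Conn-climb {l} {m} f c)

run-climb : ∀ {l m u v} D → All (Range l (m + l)) D → run D u ≡ just v →
            climb (longest l m) u ≡ climb (longest l m) v
run-climb [] [] refl = refl
run-climb {l} {m} {u} (i ∷ D) (r ∷ rs) h with F i u in eq
... | just _ = trans (F-starts {l} {m} r eq) (run-climb {l} {m} D rs h)

-- With `i` in front the first signatures agree, so F_i is defined at `u′` as well; it changes both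
-- signatures alike and keeps both tops, hence the remaining traces.
≈-F : ∀ {l m i u v u′} → Range l (m + l) i → longest l m ⊢ u ≈ u′ → F i u ≡ just v →
      ∃ λ v′ → F i u′ ≡ just v′ × longest l m ⊢ v ≈ v′
≈-F {l} {m} {i} {u} {v} {u′} r u≈u′ h with longest-starts l m r
... | D , eq with ∷-injective (proj₁ (~-trace eq) u≈u′) | F-sig {u = u} h
... | sigs , rest | _ , _ , su , sv , tops with F-defined {u = u′} (trans (sym sigs) su)
... | v′ , h′ with F-sig {u = u′} h′
... | _ , _ , su′ , sv′ , tops′ with trans (sym su) (trans sigs su′)
... | refl = v′ , h′ , proj₂ (~-trace eq) (cong₂ _∷_ (trans sv (sym sv′))
  (trans (cong (trace D) (sym tops)) (trans rest (cong (trace D) tops′))))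

≈-run : ∀ {l m u v u′} D → All (Range l (m + l)) D → longest l m ⊢ u ≈ u′ → run D u ≡ just v →
        ∃ λ v′ → run D u′ ≡ just v′ × longest l m ⊢ v ≈ v′
≈-run [] [] u≈u′ refl = _ , refl , u≈u′
≈-run {l} {m} {u} (i ∷ D) (r ∷ rs) u≈u′ h with F i u in eq
... | just _ with ≈-F {l} {m} {u = u} r u≈u′ eq
... | _ , eq′ , w≈w′ rewrite eq′ = ≈-run {l} {m} D rs w≈w′ h

≈-prefix : ∀ D E {u v} → D ++ E ⊢ u ≈ v → D ⊢ u ≈ v
≈-prefix []      E h = refl
≈-prefix (i ∷ D) E h = cong₂ _∷_ (proj₁ (∷-injective h)) (≈-prefix D E (proj₂ (∷-injective h)))

≈-init : ∀ l m {u v} → longest l (suc m) ⊢ u ≈ v → longest l m ⊢ u ≈ v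
≈-init l m = ≈-prefix (longest l m) _

≈-tail : ∀ l m {u v} → longest l (suc m) ⊢ u ≈ v → longest (suc l) m ⊢ u ≈ v
≈-tail l m h = ≈-prefix (longest (suc l) m) (asc l (suc m)) (proj₁ (~-trace (longest-asc l m)) h)

-- With `i` at the end the climb finishes with `top i`, whose φ is the sum of the two parts of the
-- last recorded signature.
≈-φ-climb : ∀ {l m i u v} → Range l (m + l) i → longest l m ⊢ u ≈ v →
            φ i (climb (longest l m) u) ≡ φ i (climb (longest l m) v)
≈-φ-climb {l} {m} {i} {u} {v} r u≈v with longest-ends l m r
... | D , eq = trans (cong (φ i) (~-climb eq u))
    (trans (last D (proj₁ (~-trace eq) u≈v)) (cong (φ i) (sym (~-climb eq v))))
  where
    last : ∀ D {u v} → D ∷ʳ i ⊢ u ≈ v → φ i (climb (D ∷ʳ i) u) ≡ φ i (climb (D ∷ʳ i) v)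
    last [] {u} {v} h = trans (cong proj₁ (sig-top i u))
      (trans (cong (λ (k , e) → k + e) (proj₁ (∷-injective h))) (sym (cong proj₁ (sig-top i v))))
    last (j ∷ D) h = last D (proj₂ (∷-injective h))

climb-source : ∀ {w} D → All (λ i → ε i w ≡ 0) D → climb D w ≡ w
climb-source []      []       = refl
climb-source {w} (i ∷ D) (h ∷ hs) rewrite top-source i w h = climb-source D hs

-- Raising fixes a source, so its trace merely lists its parameters. This is why the parameter
-- determines the crystal.
≈-source : ∀ {u v} D → All (λ i → ∃ λ k → sig i u ≡ (k , 0) × sig i v ≡ (k , 0)) D → D ⊢ u ≈ v
≈-source []      []       = refl
≈-source {u} {v} (i ∷ D) ((_ , p , q) ∷ hs)
  rewrite top-source i u (cong proj₂ p) | top-source i v (cong proj₂ q) =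
  cong₂ _∷_ (trans p (sym q)) (≈-source D hs)

ε-source : ∀ {i s} → (∀ u → ¬ (F i u ≡ just s)) → ε i s ≡ 0
ε-source {i} {s} h with ε i s in eq
... | zero  = refl
... | suc _ = let u , p = Fgo-preimage i 0 s (subst (0 <_) (sym eq) z<s) z≤n in contradiction p (h u)

iterM-φ : ∀ {i s y} L → iterM L (F i) s ≡ just y → φ i s ≡ L + φ i y
iterM-φ zero refl = refl
iterM-φ {i} {s} {y} (suc L) h with iterM L (F i) s in eq
... | just z with F-sig {u = z} h
... | m , e , p , q , _ = trans (iterM-φ L eq) (trans (cong (λ t → L + proj₁ t) p)
        (trans (+-suc L m) (cong (λ t → suc (L + proj₁ t)) (sym q))))

PathLen-φ : ∀ {i s L} → PathLen i s L → φ i s ≡ L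
PathLen-φ {i} {s} {L} ((y , h) , h′) rewrite h =
  trans (iterM-φ L h) (trans (cong (L +_) (F-undefined {u = y} h′)) (+-identityʳ L))

-- Products of columns

module _ {A : Set} where

  pw : ℕ → List A → List A
  pw n w = concat (replicate n w)

  pw-∷ʳ : ∀ n (w : List A) → pw (suc n) w ≡ pw n w ++ w
  pw-∷ʳ zero    w = ++-identityʳ w
  pw-∷ʳ (suc n) w = trans (cong (w ++_) (pw-∷ʳ n w)) (sym (++-assoc w (pw n w) w))

-- Tall columns stand on the left, opposite to `srcK`. Since S_{m,1} acts first, the block being
-- lowered has untouched sources on its left and finished sinks on its right.
cols : (ℕ → Word) → (ℕ → ℕ) → ℕ → Word
cols g y zero    = []
cols g y (suc k) = pw (y (suc k)) (g (suc k)) ++ cols g y k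

program : (ℕ → List ℕ) → (ℕ → ℕ) → ℕ → List ℕ
program ops y zero    = []
program ops y (suc k) = program ops y k ++ pw (y (suc k)) (ops (suc k))

run-++ : ∀ D E {u v} → run D u ≡ just v → run (D ++ E) u ≡ run E v
run-++ []      E refl = refl
run-++ (i ∷ D) E {u} h with F i u
... | just _ = run-++ D E h

run-split : ∀ D E u → run (D ++ E) u ≡ (run D u >>= run E)
run-split []      E u = refl
run-split (i ∷ D) E u with F i u
... | just v  = run-split D E v
... | nothing = refl

iterM-run : ∀ n D w → iterM n (run D) w ≡ run (pw n D) w
iterM-run zero    D w = refl
iterM-run (suc n) D w = trans (cong (_>>= run D) (iterM-run n D w))
  (trans (sym (run-split (pw n D) D w)) (cong (λ E → run E w) (sym (pw-∷ʳ n D))))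

prUpTo-run : ∀ o m x k s → prUpTo o m x k s ≡ run (program (SList o m) (λ j → x (o + j)) k) s
prUpTo-run o m x zero    s = refl
prUpTo-run o m x (suc k) s = trans (cong (_>>= _) (prUpTo-run o m x k s))
  (trans (bind-cong (run P s) (iterM-run (x (o + suc k)) (SList o m (suc k)))) (sym (run-split P _ s)))
  where
    P : List ℕ
    P = program (SList o m) (λ j → x (o + j)) k
    bind-cong : ∀ (a : Maybe Word) {f g} → (∀ w → f w ≡ g w) → (a >>= f) ≡ (a >>= g)
    bind-cong (just w) h = h w
    bind-cong nothing  h = refl

sig-pw : ∀ {i k} n w → sig i w ≡ (k , 0) → sig i (pw n w) ≡ (n * k , 0)
sig-pw zero    w h = refl
sig-pw {i} (suc n) w h = trans (sig-++-source i w (pw n w) (cong proj₂ h))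
  (cong₂ _,_ (cong₂ _+_ (cong proj₁ h) (cong proj₁ (sig-pw n w h))) (cong proj₂ (sig-pw n w h)))

φ-pw : ∀ {i} n w → φ i w ≡ 0 → φ i (pw n w) ≡ 0
φ-pw zero    w h = refl
φ-pw {i} (suc n) w h = trans (cong proj₁ (sig-++-sink i w (pw n w) (φ-pw n w h))) h

sig-++ : ∀ {i k k′} u v → sig i u ≡ (k , 0) → sig i v ≡ (k′ , 0) → sig i (u ++ v) ≡ (k + k′ , 0)
sig-++ {i} u v p q = trans (sig-++-source i u v (cong proj₂ p))
  (cong₂ _,_ (cong₂ _+_ (cong proj₁ p) (cong proj₁ q)) (cong proj₂ q))

sig-pw-0 : ∀ {i} n w → sig i w ≡ (0 , 0) → sig i (pw n w) ≡ (0 , 0)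
sig-pw-0 n w h = trans (sig-pw n w h) (cong (_, 0) (*-zeroʳ n))

sig-pw-1 : ∀ {i} n w → sig i w ≡ (1 , 0) → sig i (pw n w) ≡ (n , 0)
sig-pw-1 n w h = trans (sig-pw n w h) (cong (_, 0) (*-identityʳ n))

sig-cols-0 : ∀ {i g} y m → (∀ k → k < m → sig i (g (suc k)) ≡ (0 , 0)) → sig i (cols g y m) ≡ (0 , 0)
sig-cols-0 y zero    h = refl
sig-cols-0 {g = g} y (suc m) h =
  sig-++ (pw (y (suc m)) (g (suc m))) _ (sig-pw-0 (y (suc m)) _ (h m ≤-refl))
      (sig-cols-0 y m (λ k k<m → h k (m<n⇒m<1+n k<m)))

sig-cols-1 : ∀ {i g} y m j → j < m → sig i (g (suc j)) ≡ (1 , 0) →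
             (∀ k → k < m → k ≢ j → sig i (g (suc k)) ≡ (0 , 0)) → sig i (cols g y m) ≡ (y (suc j) , 0)
sig-cols-1 {g = g} y (suc m) j j< h h′ with m≤n⇒m<n∨m≡n (s≤s⁻¹ j<)
... | inj₁ j<m  = sig-++ (pw (y (suc m)) (g (suc m))) _ (sig-pw-0 (y (suc m)) _ (h′ m ≤-refl (≢-sym (<⇒≢ j<m))))
  (sig-cols-1 y m j j<m h (λ k k<m → h′ k (m<n⇒m<1+n k<m)))
... | inj₂ refl = trans (sig-++ (pw (y (suc m)) (g (suc m))) _ (sig-pw-1 (y (suc m)) _ h)
    (sig-cols-0 y m (λ k k<m → h′ k (m<n⇒m<1+n k<m) (<⇒≢ k<m)))) (cong (_, 0) (+-identityʳ _))

module _ (P : ℕ → Set) where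

  Source Sink : Word → Set
  Source w = ∀ {i} → P i → ε i w ≡ 0
  Sink   w = ∀ {i} → P i → φ i w ≡ 0

  Source-++ : ∀ u v → Source u → Source v → Source (u ++ v)
  Source-++ u v p q {i} r = trans (cong proj₂ (sig-++-source i u v (p r))) (q r)

  Sink-++ : ∀ u v → Sink u → Sink v → Sink (u ++ v)
  Sink-++ u v p q {i} r = trans (cong proj₁ (sig-++-sink i u v (q r))) (p r)

  Source-pw : ∀ n w → Source w → Source (pw n w)
  Source-pw zero    w h r = refl
  Source-pw (suc n) w h   = Source-++ w (pw n w) h (Source-pw n w h)

  Sink-pw : ∀ n w → Sink w → Sink (pw n w)
  Sink-pw n w h r = φ-pw n w (h r)

  Sink-cols : ∀ g y m → (∀ k → k < m → Sink (g (suc k))) → Sink (cols g y m)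
  Sink-cols g y zero    h r = refl
  Sink-cols g y (suc m) h = Sink-++ (pw (y (suc m)) (g (suc m))) _ (Sink-pw (y (suc m)) _ (h m ≤-refl))
    (Sink-cols g y m (λ k k<m → h k (m<n⇒m<1+n k<m)))

  -- D lowers w to w′ inside every product X w Z in which neither X nor Z
  -- interferes with the colours P.
  Lowers : List ℕ → Word → Word → Set
  Lowers D w w′ = ∀ X Z → Source X → Sink Z → run D (X ++ w ++ Z) ≡ just (X ++ w′ ++ Z)

  -- The copies are lowered from right to left, for the same reason as in `cols`.
  Lowers-pw : ∀ n D w w′ → Source w → Sink w′ → Lowers D w w′ → Lowers (pw n D) (pw n w) (pw n w′)
  Lowers-pw zero    D w w′ Sw Sw′ h X Z SX SZ = refl
  Lowers-pw (suc n) D w w′ Sw Sw′ h X Z SX SZ = trans (cong (run (pw (suc n) D)) shape)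
    (trans (run-++ D (pw n D) (h (X ++ pw n w) Z (Source-++ X (pw n w) SX (Source-pw n w Sw)) SZ))
    (trans (cong (run (pw n D)) (++-assoc X (pw n w) (w′ ++ Z)))
    (trans (Lowers-pw n D w w′ Sw Sw′ h X (w′ ++ Z) SX (Sink-++ w′ Z Sw′ SZ))
    (cong (λ V → just (X ++ V)) (trans (sym (++-assoc (pw n w′) w′ Z)) (cong (_++ Z) (sym (pw-∷ʳ n w′))))))))
    where
      shape : X ++ pw (suc n) w ++ Z ≡ (X ++ pw n w) ++ w ++ Z
      shape = trans (cong (λ V → X ++ V ++ Z) (pw-∷ʳ n w))
        (trans (cong (X ++_) (++-assoc (pw n w) w Z)) (sym (++-assoc X (pw n w) (w ++ Z))))

  program-run : ∀ ops g g′ y m →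
    (∀ k → k < m → Source (g (suc k)) × Sink (g′ (suc k)) × Lowers (ops (suc k)) (g (suc k)) (g′ (suc k))) →
    ∀ X → Source X → run (program ops y m) (X ++ cols g y m) ≡ just (X ++ cols g′ y m)
  program-run ops g g′ y zero    h X SX = refl
  program-run ops g g′ y (suc m) h X SX =
    trans (cong (run (program ops y (suc m))) (sym (++-assoc X W (cols g y m))))
    (trans (run-++ (program ops y m) _ (program-run ops g g′ y m h′ (X ++ W)
        (Source-++ X W SX (Source-pw (y (suc m)) _ SW))))
    (trans (cong (run (pw (y (suc m)) (ops (suc m)))) (++-assoc X W (cols g′ y m)))
           (Lowers-pw (y (suc m)) (ops (suc m)) (g (suc m)) (g′ (suc m)) SW SW′ SL X (cols g′ y m) SX
               (Sink-cols g′ y m (λ k k<m → proj₁ (proj₂ (h′ k k<m)))))))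
    where
      W : Word
      W = pw (y (suc m)) (g (suc m))
      SW = proj₁ (h m ≤-refl)
      SW′ = proj₁ (proj₂ (h m ≤-refl))
      SL = proj₂ (proj₂ (h m ≤-refl))
      h′ = λ k k<m → h k (m<n⇒m<1+n k<m)

-- Columns of consecutive letters

sig-desc-above : ∀ {i} p k → k + p ≤ i → sig i (desc p k) ≡ (0 , 0)
sig-desc-above p zero    h = refl
sig-desc-above {i} p (suc k) h =
  sig-∷ i (desc p k) (sig-desc-above p k (<⇒≤ h)) (skip (<⇒≢ h) (<⇒≢ (m<n⇒m<1+n h)))

sig-desc-end : ∀ p k → sig (k + p) (desc p (suc k)) ≡ (1 , 0)
sig-desc-end p k = sig-∷ (k + p) (desc p k) (sig-desc-above p k ≤-refl) close

sig-desc-inside : ∀ {i} p k → p ≤ i → suc i < k + p → sig i (desc p k) ≡ (0 , 0)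
sig-desc-inside p zero    p≤i i<p = contradiction p≤i (<⇒≱ (<⇒≤ i<p))
sig-desc-inside {i} p (suc k) p≤i i< with m≤n⇒m<n∨m≡n (s≤s⁻¹ i<)
... | inj₁ h = sig-∷ i (desc p k) (sig-desc-inside p k p≤i h) (skip (≢-sym (<⇒≢ (<⇒≤ h))) (≢-sym (<⇒≢ h)))
sig-desc-inside {i} p (suc zero)    p≤i i< | inj₂ refl = contradiction p≤i (<⇒≱ ≤-refl)
sig-desc-inside {i} p (suc (suc k)) p≤i i< | inj₂ refl = sig-∷ (k + p) (desc p (suc k)) (sig-desc-end p k) match

sig-desc-other : ∀ {i} p k → p ≤ i → suc i ≢ k + p → sig i (desc p k) ≡ (0 , 0)
sig-desc-other {i} p k p≤i h with k + p ≤? i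
... | yes q = sig-desc-above p k q
... | no q  = sig-desc-inside p k p≤i (≤∧≢⇒< (≰⇒> q) h)

φ-∷ : ∀ {i x} xs → x ≢ i → φ i xs ≡ 0 → φ i (x ∷ xs) ≡ 0
φ-∷ {i} {x} xs p h with sig i xs in eq
... | s with step i x s
... | _ , _ , close    = contradiction refl p
... | _ , _ , raise    = refl
... | _ , _ , skip _ _ = h

φ-desc : ∀ {i} p k → suc i < k + p → φ i (desc p k) ≡ 0
φ-desc {i} p k h with p ≤? i
... | yes p≤i = cong proj₁ (sig-desc-inside p k p≤i h)
... | no p≰i  = absent k
  where
    absent : ∀ k → φ i (desc p k) ≡ 0
    absent zero    = refl
    absent (suc k) = φ-∷ (desc p k) (≢-sym (<⇒≢ (≤-trans (≰⇒> p≰i) (m≤n+m p k)))) (absent k)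

-- `desc p k` has two readings: a column of height `k`, and the colour list of an operator w_{m,k,j}
-- that shifts this column up by one letter. The concatenation is S_{m,k}; see `SList-slides`.
slides : ℕ → ℕ → ℕ → List ℕ
slides p zero    k = []
slides p (suc r) k = desc p k ++ slides (suc p) r k

All-slides : ∀ {l h} p r k → l ≤ p → r + (k + p) ≤ suc h → All (Range l h) (slides p r k)
All-slides p zero    k l≤p r≤ = []
All-slides {l} {h} p (suc r) k l≤p r≤ =
  ++⁺ (All.map (λ (q , q′) → ≤-trans l≤p q , ≤-trans q′ (≤-trans (m≤n+m (k + p) r) (s≤s⁻¹ r≤))) (All-desc p k))
      (All-slides (suc p) r k (m≤n⇒m≤1+n l≤p)
          (≤-trans (≤-reflexive (trans (cong (r +_) (+-suc k p)) (+-suc r (k + p)))) r≤))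

φ-desc-++ : ∀ p k {Z} → φ (k + p) Z ≡ 0 → φ (k + p) (desc p k ++ Z) ≡ 0
φ-desc-++ p k {Z} h = trans (cong proj₁ (sig-++-sink (k + p) (desc p k) Z h))
    (cong proj₁ (sig-desc-above p k ≤-refl))

-- Each colour acts on the letter of the same name: sources stand on its left, and the smaller
-- letters of the column after it do not interfere.
Lowers-desc : ∀ {l h} p k → l ≤ p → k + p ≤ h → Lowers (Range l h) (desc p k) (desc p k) (desc (suc p) k)
Lowers-desc p zero    l≤p k≤ X Z SX SZ = refl
Lowers-desc {l} {h} p (suc k) l≤p k≤ X Z SX SZ
  rewrite F-at (k + p) X (desc p k ++ Z) (SX (≤-trans l≤p (m≤n+m p k) , k≤))
    (φ-desc-++ p k (SZ (≤-trans l≤p (m≤n+m p k) , k≤))) =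
  trans (cong (run (desc p k)) (sym (∷ʳ-++ X (suc (k + p)) (desc p k ++ Z))))
  (trans (Lowers-desc p k ≤-refl ≤-refl (X ∷ʳ suc (k + p)) Z SX′ (λ r → SZ (restrict r)))
  (cong just (trans (∷ʳ-++ X (suc (k + p)) (desc (suc p) k ++ Z))
      (cong (λ a → X ++ a ∷ desc (suc p) k ++ Z) (sym (+-suc k p))))))
  where
    restrict : ∀ {i} → Range p (k + p) i → Range l h i
    restrict (q , q′) = ≤-trans l≤p q , ≤-trans (m<n⇒m<1+n q′) k≤
    SX′ : Source (Range p (k + p)) (X ∷ʳ suc (k + p))
    SX′ r@(q , q′) = Source-++ (Range p (k + p)) X _ (λ r → SX (restrict r))
      (λ {i} (_ , s) → cong proj₂ (sig-∷ i [] refl (skip (≢-sym (<⇒≢ (m<n⇒m<1+n s))) (≢-sym (<⇒≢ (s≤s s)))))) r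

Lowers-slides : ∀ {l h} p r k → l ≤ p → r + (k + p) ≤ suc h →
                Lowers (Range l h) (slides p r k) (desc p k) (desc (r + p) k)
Lowers-slides p zero    k l≤p r≤ X Z SX SZ = refl
Lowers-slides p (suc r) k l≤p r≤ X Z SX SZ =
  trans (run-++ (desc p k) _ (Lowers-desc p k l≤p (≤-trans (m≤n+m (k + p) r) (s≤s⁻¹ r≤)) X Z SX SZ))
  (trans (Lowers-slides (suc p) r k (m≤n⇒m≤1+n l≤p)
      (≤-trans (≤-reflexive (trans (cong (r +_) (+-suc k p)) (+-suc r (k + p)))) r≤) X Z SX SZ)
  (cong (λ a → just (X ++ desc a k ++ Z)) (+-suc r p)))

wList-desc : ∀ o k j → wList o k j ≡ desc (o + j) k
wList-desc o k j = trans (cong reverse (map-upTo (λ t → o + j + t) k))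
  (trans (reverse-applyUpTo (λ t → o + j + t) k) (go k))
  where
    go : ∀ k → applyDownFrom (λ t → o + j + t) k ≡ desc (o + j) k
    go zero    = refl
    go (suc k) = cong₂ _∷_ (+-comm (o + j) k) (go k)

SList-slides : ∀ o m k → SList o m k ≡ slides (suc o) (suc (m ∸ k)) k
SList-slides o m k = trans (cong (concatMap (wList o k)) (map-upTo suc (suc (m ∸ k))))
  (go suc (suc o) (suc (m ∸ k)) (λ j → trans (+-suc o j) (+-comm (suc o) j)))
  where
    go : ∀ f p r → (∀ j → o + f j ≡ j + p) → concatMap (wList o k) (applyUpTo f r) ≡ slides p r k
    go f p zero    h = refl
    go f p (suc r) h = cong₂ _++_ (trans (wList-desc o k (f 0)) (cong (λ a → desc a k) (h 0)))
      (go (λ j → f (suc j)) (suc p) r (λ j → trans (h (suc j)) (sym (+-suc j p))))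

column-desc : ∀ k → column k ≡ desc 1 k
column-desc k = trans (cong reverse (map-upTo suc k)) (trans (reverse-applyUpTo suc k) (go k))
  where
    go : ∀ k → applyDownFrom suc k ≡ desc 1 k
    go zero    = refl
    go (suc k) = cong₂ _∷_ (+-comm 1 k) (go k)

ε-desc : ∀ {i} p k → p ≤ i → ε i (desc p k) ≡ 0
ε-desc {i} p k p≤i with suc i ≟ k + p
ε-desc p zero    p≤i | yes refl = refl
ε-desc p (suc k) p≤i | yes refl = cong proj₂ (sig-desc-end p k)
... | no h = cong proj₂ (sig-desc-other p k p≤i h)

Source-cols : ∀ P g y m → (∀ k → k < m → Source P (g (suc k))) → Source P (cols g y m)
Source-cols P g y zero    h r = refl
Source-cols P g y (suc m) h = Source-++ P (pw (y (suc m)) (g (suc m))) _ (Source-pw P (y (suc m)) _ (h m ≤-refl))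
  (Source-cols P g y m (λ k k<m → h k (m<n⇒m<1+n k<m)))

cols-cong : ∀ g g′ y m → (∀ k → k < m → g (suc k) ≡ g′ (suc k)) → cols g y m ≡ cols g′ y m
cols-cong g g′ y zero    h = refl
cols-cong g g′ y (suc m) h = cong₂ _++_ (cong (pw (y (suc m))) (h m ≤-refl))
  (cols-cong g g′ y m (λ k k<m → h k (m<n⇒m<1+n k<m)))

All-pw : ∀ {P : ℕ → Set} n {D} → All P D → All P (pw n D)
All-pw zero    ps = []
All-pw (suc n) ps = ++⁺ ps (All-pw n ps)

All-program : ∀ {P : ℕ → Set} ops y m → (∀ k → k < m → All P (ops (suc k))) → All P (program ops y m)
All-program ops y zero    h = []
All-program ops y (suc m) h = ++⁺ (All-program ops y m (λ k k<m → h k (m<n⇒m<1+n k<m)))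
    (All-pw (y (suc m)) (h m ≤-refl))

-- The lowest word of the component of desc (suc o) k with colours suc o , … , o + m.
lowest : ℕ → ℕ → ℕ → Word
lowest o m k = desc (suc (m ∸ k) + suc o) k

SList-bound : ∀ o m k → k < m → suc (m ∸ suc k) + (suc k + suc o) ≤ suc (m + suc o)
SList-bound o m k k<m = ≤-reflexive (cong suc
  (trans (sym (+-assoc (m ∸ suc k) (suc k) (suc o))) (cong (_+ suc o) (m∸n+n≡m k<m))))

All-SList : ∀ o m k → k < m → All (Range (suc o) (m + suc o)) (SList o m (suc k))
All-SList o m k k<m = subst (All _) (sym (SList-slides o m (suc k)))
  (All-slides (suc o) (suc (m ∸ suc k)) (suc k) ≤-refl (SList-bound o m k k<m))

Lowers-SList : ∀ o m k → k < m →
  Lowers (Range (suc o) (m + suc o)) (SList o m (suc k)) (desc (suc o) (suc k)) (lowest o m (suc k))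
Lowers-SList o m k k<m X Z SX SZ = trans (cong (λ D → run D _) (SList-slides o m (suc k)))
  (Lowers-slides (suc o) (suc (m ∸ suc k)) (suc k) ≤-refl (SList-bound o m k k<m) X Z SX SZ)

lowest-top : ∀ o m k → k < m → k + (suc (m ∸ suc k) + suc o) ≡ m + suc o
lowest-top o m k k<m = trans (sym (+-assoc k (suc (m ∸ suc k)) (suc o)))
  (cong (_+ suc o) (trans (+-suc k (m ∸ suc k)) (m+[n∸m]≡n k<m)))

Sink-lowest : ∀ o m k → k < m → Sink (Range (suc o) (m + suc o)) (lowest o m (suc k))
Sink-lowest o m k k<m (_ , i<) = φ-desc _ (suc k) (s≤s (≤-trans i< (≤-reflexive (sym (lowest-top o m k k<m)))))

sig-cols-desc : ∀ o y m j → j < m → sig (j + suc o) (cols (desc (suc o)) y m) ≡ (y (suc j) , 0)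
sig-cols-desc o y m j j<m = sig-cols-1 y m j j<m (sig-desc-end (suc o) j)
  (λ k _ k≢j → sig-desc-other (suc o) (suc k) (m≤n+m (suc o) j)
    (λ eq → k≢j (sym (+-cancelʳ-≡ (suc o) j k (suc-injective eq)))))

-- With c - x columns of each height in `X` and x in the other factor, the product has the
-- parameters of `s`, so the run from `s` can be copied on it.
principal-≈ : ∀ o m {c x s y} → (∀ {i} → Range (suc o) (m + suc o) i → sig i s ≡ (c i , 0)) →
  (∀ {i} → Range (suc o) (m + suc o) i → x i ≤ c i) → principal o m x s ≡ just y →
  longest (suc o) m ⊢ y ≈
    (cols (desc (suc o)) (λ k → c (o + k) ∸ x (o + k)) m ++ cols (lowest o m) (λ k → x (o + k)) m)
principal-≈ o m {c} {x} {s} {y} hs x≤c h = conclude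
  (≈-run {suc o} {m} P (All-program (SList o m) x′ m (All-SList o m))
         (≈-source (longest (suc o) m) (All.map (λ {i} r → c i , hs r , params r) (All-longest (suc o) m)))
         (trans (sym (prUpTo-run o m x m s)) h))
  where
    x′ : ℕ → ℕ
    x′ k = x (o + k)
    C : ℕ → Word
    C = desc (suc o)
    X : Word
    X = cols C (λ k → c (o + k) ∸ x (o + k)) m
    P : List ℕ
    P = program (SList o m) x′ m
    params : ∀ {i} → Range (suc o) (m + suc o) i → sig i (X ++ cols C x′ m) ≡ (c i , 0)
    params {i} r@(o<i , i<) = subst (λ a → sig a (X ++ cols C x′ m) ≡ (c a , 0)) (m∸n+n≡m o<i)
      (trans (sig-++ X _ (sig-cols-desc o _ m j j<m) (sig-cols-desc o x′ m j j<m))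
             (cong (_, 0) (trans (m∸n+n≡m (subst (λ a → x a ≤ c a) (sym shift)
                 (x≤c (subst (Range (suc o) (m + suc o)) (sym (m∸n+n≡m o<i)) r)))) (cong c shift))))
      where
        j : ℕ
        j = i ∸ suc o
        j<m : j < m
        j<m = +-cancelʳ-< (suc o) j m (≤-trans (s≤s (≤-reflexive (m∸n+n≡m o<i))) i<)
        shift : o + suc j ≡ j + suc o
        shift = trans (+-suc o j) (+-comm (suc o) j)
    conclude : ∃ (λ y′ → run P (X ++ cols C x′ m) ≡ just y′ × longest (suc o) m ⊢ y ≈ y′) →
               longest (suc o) m ⊢ y ≈ (X ++ cols (lowest o m) x′ m)
    conclude (y′ , h′ , y≈y′) = trans y≈y′ (cong (trace (longest (suc o) m)) (just-injective (trans (sym h′)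
      (program-run (Range (suc o) (m + suc o)) (SList o m) C (lowest o m) x′ m
        (λ k k<m → (λ (r , _) → ε-desc (suc o) (suc k) r) , Sink-lowest o m k k<m , Lowers-SList o m k k<m)
        X (Source-cols (Range (suc o) (m + suc o)) C (λ k → c (o + k) ∸ x (o + k)) m
            (λ k _ (r , _) → ε-desc (suc o) (suc k) r))))))

-- Below, n = 2 + m, so that the middle colours 2 , … , n - 1 are those of longest 2 m; f is
-- the part of a lowest column that the middle colours do not see.
module Middle (m : ℕ) (f : Word) (inert : ∀ {i} → Range 2 (m + 2) i → sig i f ≡ (0 , 0)) where

  Mid : ℕ → Set
  Mid = Range 2 (m + 2)

  -- The highest and lowest positions, for the middle colours, of a column with `h` letters in 2 ,
  -- ... , m + 2.
  start final : ℕ → Word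
  start h = f ++ desc 2 h
  final h = f ++ desc (suc m ∸ h + 2) h

  bound : ∀ h → h ≤ suc m → suc m ∸ h + (h + 2) ≡ suc (m + 2)
  bound h h≤ = trans (sym (+-assoc (suc m ∸ h) h 2)) (cong (_+ 2) (m∸n+n≡m h≤))

  Source-start : ∀ h → Source Mid (start h)
  Source-start h = Source-++ Mid f (desc 2 h) (λ r → cong proj₂ (inert r)) (λ (r , _) → ε-desc 2 h r)

  Sink-final : ∀ h → h ≤ suc m → Sink Mid (final h)
  Sink-final h h≤ = Sink-++ Mid f (desc (suc m ∸ h + 2) h) (λ r → cong proj₁ (inert r))
    (λ (_ , i<) → φ-desc _ h (≤-trans (s≤s i<)
        (≤-reflexive (sym (trans (x∙yz≈y∙xz h (suc m ∸ h) 2) (bound h h≤))))))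

  Lowers-start : ∀ h → h ≤ suc m → Lowers Mid (slides 2 (suc m ∸ h) h) (start h) (final h)
  Lowers-start h h≤ X Z SX SZ =
    trans (cong (run D) (regroup (desc 2 h)))
    (trans (Lowers-slides 2 (suc m ∸ h) h ≤-refl (≤-reflexive (bound h h≤)) (X ++ f) Z
             (Source-++ Mid X f SX (λ r → cong proj₂ (inert r))) SZ)
           (cong just (sym (regroup (desc (suc m ∸ h + 2) h)))))
    where
      D : List ℕ
      D = slides 2 (suc m ∸ h) h
      regroup : ∀ w → X ++ (f ++ w) ++ Z ≡ (X ++ f) ++ w ++ Z
      regroup w = trans (cong (X ++_) (++-assoc f w Z)) (sym (++-assoc X f (w ++ Z)))

  -- A program of middle colours leads down from `X ++ cols G x M` to the word equivalent to `y`, so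
  -- that product is the climb. Colour `2 + t` is fed by the columns with largest letter `2 + t`:
  -- those of index `suc jd` in `X` and those of visible height `suc t` in the other factor.
  φ-source : ∀ {t o M d x y} (h : ℕ → ℕ) jd jx → t < m → o ≤ 1 → jd < M → jd + suc o ≡ 2 + t →
    (∀ {k} → k < M → h (suc k) ≤ suc m) → jx < M → h (suc jx) ≡ suc t → (∀ {k} → h (suc k) ≡ suc t → k ≡ jx) →
    longest 2 m ⊢ y ≈ (cols (desc (suc o)) d M ++ cols (λ k → final (h k)) x M) →
    φ (2 + t) (climb (longest 2 m) y) ≡ d (suc jd) + x (suc jx)
  φ-source {t} {o} {M} {d} {x} {y} h jd jx t<m o≤1 jd< jd≡ h≤ jx< jx≡ unique y≈ =
    trans (≈-φ-climb {2} {m} mid y≈)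
    (trans (cong (φ (2 + t)) (trans (sym (run-climb {2} {m} (program ops x M)
        (All-program ops x M colours) lowered))
                                    (climb-source (longest 2 m) (All.map source (All-longest 2 m)))))
           (cong proj₁ (sig-++ X (cols G x M)
             (subst (λ a → sig a X ≡ (d (suc jd) , 0)) jd≡ (sig-cols-desc o d M jd jd<))
             (sig-cols-1 x M jx jx< end others))))
    where
      G : ℕ → Word
      G k = start (h k)
      ops : ℕ → List ℕ
      ops k = slides 2 (suc m ∸ h k) (h k)
      X : Word
      X = cols (desc (suc o)) d M
      mid : Mid (2 + t)
      mid = m≤m+n 2 t , ≤-trans (s≤s (s≤s (s≤s ≤-refl))) (≤-trans (s≤s (s≤s t<m)) (≤-reflexive (+-comm 2 m)))
      SX : Source Mid X
      SX = Source-cols Mid _ d M (λ k _ (r , _) → ε-desc (suc o) (suc k) (≤-trans (s≤s o≤1) r))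
      colours : ∀ k → k < M → All Mid (ops (suc k))
      colours k k< = All-slides 2 (suc m ∸ h (suc k)) (h (suc k)) ≤-refl (≤-reflexive (bound _ (h≤ k<)))
      lowered : run (program ops x M) (X ++ cols G x M) ≡ just (X ++ cols (λ k → final (h k)) x M)
      lowered = program-run Mid ops G (λ k → final (h k)) x M
        (λ k k< → Source-start (h (suc k)) , Sink-final (h (suc k)) (h≤ k<) , Lowers-start (h (suc k)) (h≤ k<)) X SX
      source : ∀ {i} → Mid i → ε i (X ++ cols G x M) ≡ 0
      source = Source-++ Mid X (cols G x M) SX (Source-cols Mid G x M (λ k _ → Source-start (h (suc k))))
      end : sig (2 + t) (G (suc jx)) ≡ (1 , 0)
      end = sig-++ f (desc 2 (h (suc jx))) (inert mid)
        (subst (λ a → sig (2 + t) (desc 2 a) ≡ (1 , 0)) (sym jx≡)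
          (subst (λ a → sig a (desc 2 (suc t)) ≡ (1 , 0)) (+-comm t 2) (sig-desc-end 2 t)))
      others : ∀ k → k < M → k ≢ jx → sig (2 + t) (G (suc k)) ≡ (0 , 0)
      others k _ k≢ = sig-++ f (desc 2 (h (suc k))) (inert mid)
        (sig-desc-other 2 (h (suc k)) (m≤m+n 2 t)
          (λ eq → k≢ (unique (sym (+-cancelʳ-≡ 2 (suc t) (h (suc k)) (trans (+-comm (suc t) 2) eq))))))

-- Letter counts

δ : ℕ → ℕ → ℕ
δ x y = if x ≡ᵇ y then 1 else 0

occ : ℕ → List ℕ → ℕ
occ x []       = 0
occ x (y ∷ ys) = δ x y + occ x ys

δ-≡ : ∀ x → δ x x ≡ 1
δ-≡ zero    = refl
δ-≡ (suc x) = δ-≡ x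

δ-≢ : ∀ {x y} → x ≢ y → δ x y ≡ 0
δ-≢ {zero}  {zero}  h = contradiction refl h
δ-≢ {zero}  {suc y} h = refl
δ-≢ {suc x} {zero}  h = refl
δ-≢ {suc x} {suc y} h = δ-≢ (λ p → h (cong suc p))

occ-++ : ∀ x u v → occ x (u ++ v) ≡ occ x u + occ x v
occ-++ x []      v = refl
occ-++ x (y ∷ u) v = trans (cong (δ x y +_) (occ-++ x u v)) (sym (+-assoc (δ x y) (occ x u) (occ x v)))

occ-absent : ∀ {x w} → All (x ≢_) w → occ x w ≡ 0
occ-absent []       = refl
occ-absent (p ∷ ps) = cong₂ _+_ (δ-≢ p) (occ-absent ps)

+-prefix : ∀ a b c {d e} → b + d ≡ c + e → (a + b) + d ≡ (a + c) + e
+-prefix a b c h = trans (+-assoc a b _) (trans (cong (a +_) h) (sym (+-assoc a c _)))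

-- One `i` becomes `suc i`; losses are added on the other side to stay in ℕ.
Fgo-occ : ∀ i k u {v} x → Fgo i k u ≡ just v → occ (suc x) v + δ (suc x) i ≡ occ (suc x) u + δ x i
Fgo-occ i k (y ∷ ys) x h with kind i y
Fgo-occ i k (y ∷ ys) x h | high rewrite Fgo-open i k ys with Fgo i (suc k) ys in eq | h
... | just zs | refl = +-prefix (δ (suc x) (suc i)) (occ (suc x) zs) (occ (suc x) ys) (Fgo-occ i (suc k) ys x eq)
Fgo-occ i k (y ∷ ys) x h | other p q rewrite Fgo-skip i k ys p q with Fgo i k ys in eq | h
... | just zs | refl = +-prefix (δ (suc x) y) (occ (suc x) zs) (occ (suc x) ys) (Fgo-occ i k ys x eq)
Fgo-occ i (suc k) (y ∷ ys) x h | low rewrite Fgo-match i k ys with Fgo i k ys in eq | h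
... | just zs | refl = +-prefix (δ (suc x) i) (occ (suc x) zs) (occ (suc x) ys) (Fgo-occ i k ys x eq)
Fgo-occ i zero (y ∷ ys) x h | low with Fgo i 0 ys in eq
... | just zs with refl ← trans (sym h) (Fgo-close i eq) =
  +-prefix (δ (suc x) i) (occ (suc x) zs) (occ (suc x) ys) (Fgo-occ i 0 ys x eq)
... | nothing with refl ← trans (sym h) (Fgo-lower i eq) = rotate (δ x i) (occ (suc x) ys) (δ (suc x) i)
  where
    rotate : ∀ a b c → (a + b) + c ≡ (c + b) + a
    rotate = solve-∀

run-occ : ∀ x D {u v} → run D u ≡ just v → occ (suc x) v + occ (suc x) D ≡ occ (suc x) u + occ x D
run-occ x []      refl = refl
run-occ x (i ∷ D) {u} {v} h with F i u in eq
... | just w = begin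
  occ (suc x) v + (δ (suc x) i + occ (suc x) D) ≡⟨ x∙yz≈y∙xz (occ (suc x) v) (δ (suc x) i) (occ (suc x) D) ⟩
  δ (suc x) i + (occ (suc x) v + occ (suc x) D) ≡⟨ cong (δ (suc x) i +_) (run-occ x D h) ⟩
  δ (suc x) i + (occ (suc x) w + occ x D)       ≡⟨ +-assoc (δ (suc x) i) (occ (suc x) w) (occ x D) ⟨
  (δ (suc x) i + occ (suc x) w) + occ x D       ≡⟨ cong (_+ occ x D) (+-comm (δ (suc x) i) _) ⟩
  (occ (suc x) w + δ (suc x) i) + occ x D       ≡⟨ cong (_+ occ x D) (Fgo-occ _ _ u x eq) ⟩
  (occ (suc x) u + δ x i) + occ x D             ≡⟨ +-assoc (occ (suc x) u) (δ x i) (occ x D) ⟩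
  occ (suc x) u + (δ x i + occ x D)             ∎
  where open ≡-Reasoning

F-occ : ∀ {x i} u v → suc x ≢ i × x ≢ i → F i u ≡ just v → occ (suc x) u ≡ occ (suc x) v
F-occ {x} u v (p , q) h = sym (trans (sym (+-identityʳ _)) (trans (cong (λ a → occ (suc x) v + a) (sym (δ-≢ p)))
  (trans (Fgo-occ _ _ u x h) (trans (cong (λ a → occ (suc x) u + a) (δ-≢ q)) (+-identityʳ _)))))

Conn-occ : ∀ {x I u v} → (∀ {i} → I i → suc x ≢ i × x ≢ i) → Conn I u v → occ (suc x) u ≡ occ (suc x) v
Conn-occ f here = refl
Conn-occ f (fwd (edge {i} {u} {v} i∈I h) c) = trans (F-occ u v (f i∈I) h) (Conn-occ f c)
Conn-occ f (bwd (edge {i} {u} {v} i∈I h) c) = trans (sym (F-occ u v (f i∈I) h)) (Conn-occ f c)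

occ-pw : ∀ x n w → occ x (pw n w) ≡ n * occ x w
occ-pw x zero    w = refl
occ-pw x (suc n) w = trans (occ-++ x w (pw n w)) (cong (occ x w +_) (occ-pw x n w))

Σ[_] : (ℕ → ℕ) → ℕ → ℕ
Σ[ y ] zero    = 0
Σ[ y ] (suc k) = Σ[ y ] k + y (suc k)

occ-program : ∀ {x} ops y m → (∀ k → k < m → occ x (ops (suc k)) ≡ 1) → occ x (program ops y m) ≡ Σ[ y ] m
occ-program ops y zero    h = refl
occ-program {x} ops y (suc m) h = trans (occ-++ x (program ops y m) _)
    (cong₂ _+_ (occ-program ops y m (λ k k<m → h k (m<n⇒m<1+n k<m)))
  (trans (occ-pw x (y (suc m)) (ops (suc m))) (trans (cong (y (suc m) *_) (h m ≤-refl)) (*-identityʳ _))))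

occ-desc-bottom : ∀ p k → occ p (desc p (suc k)) ≡ 1
occ-desc-bottom p zero    = cong (_+ 0) (δ-≡ p)
occ-desc-bottom p (suc k) = cong₂ _+_ (δ-≢ (<⇒≢ (s≤s (m≤n+m p k)))) (occ-desc-bottom p k)

occ-desc-top : ∀ p k → occ (k + p) (desc p (suc k)) ≡ 1
occ-desc-top p k = cong₂ _+_ (δ-≡ (k + p)) (occ-absent (All.map (λ (_ , q) → ≢-sym (<⇒≢ q)) (All-desc p k)))

SList-column : ∀ o m k → k < m → run (SList o m (suc k)) (desc (suc o) (suc k)) ≡ just (lowest o m (suc k))
SList-column o m k k<m = trans (cong (run (SList o m (suc k))) (sym (++-identityʳ (desc (suc o) (suc k)))))
  (trans (Lowers-SList o m k k<m [] [] (λ _ → refl) (λ _ → refl)) (cong just (++-identityʳ _)))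

-- Read off from one column: the highest column has the letter `suc o` once and the lowest not at
-- all, and each use of colour `suc o` removes one.
occ-SList-bottom : ∀ o m k → k < m → occ (suc o) (SList o m (suc k)) ≡ 1
occ-SList-bottom o m k k<m = trans (cong (_+ occ (suc o) (SList o m (suc k))) (sym none-left))
  (trans (run-occ o (SList o m (suc k)) {desc (suc o) (suc k)} (SList-column o m k k<m))
  (trans (cong₂ _+_ (occ-desc-bottom (suc o) k)
      (occ-absent (All.map (λ (p , _) → <⇒≢ p) (All-SList o m k k<m)))) refl))
  where
    none-left : occ (suc o) (lowest o m (suc k)) ≡ 0
    none-left = occ-absent (All.map (λ (p , _) → <⇒≢ (≤-trans (s≤s (m≤n+m (suc o) (m ∸ suc k))) p))
        (All-desc _ (suc k)))

occ-SList-top : ∀ o m k → k < m → occ (m + o) (SList o m (suc k)) ≡ 1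
occ-SList-top o m k k<m = trans (cong (_+ occ (m + o) (SList o m (suc k))) (sym none-before))
  (trans (sym (run-occ (m + o) (SList o m (suc k)) {desc (suc o) (suc k)} (SList-column o m k k<m)))
         (cong₂ _+_ one-after (occ-absent (All.map
             (λ (_ , q) → ≢-sym (<⇒≢ (≤-trans q (≤-reflexive (+-suc m o))))) (All-SList o m k k<m)))))
  where
    none-before : occ (suc (m + o)) (desc (suc o) (suc k)) ≡ 0
    none-before = occ-absent (All.map (λ (_ , q) → ≢-sym
        (<⇒≢ (≤-trans q (≤-trans (+-monoˡ-≤ (suc o) k<m) (≤-reflexive (+-suc m o)))))) (All-desc (suc o) (suc k)))
    one-after : occ (suc (m + o)) (lowest o m (suc k)) ≡ 1
    one-after = subst (λ a → occ a (lowest o m (suc k)) ≡ 1) (trans (lowest-top o m k k<m) (+-suc m o))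
        (occ-desc-top _ k)

module _ (o m : ℕ) {x : ℕ → ℕ} {s v : Word} (h : principal o m x s ≡ just v) where

  private
    x′ : ℕ → ℕ
    x′ k = x (o + k)

    P : List ℕ
    P = program (SList o m) x′ m

    P-range : All (Range (suc o) (m + suc o)) P
    P-range = All-program (SList o m) x′ m (All-SList o m)

    runs : run P s ≡ just v
    runs = trans (sym (prUpTo-run o m x m s)) h

  principal-occ-bottom : occ (suc o) v + Σ[ x′ ] m ≡ occ (suc o) s
  principal-occ-bottom = trans (cong (occ (suc o) v +_) (sym (occ-program (SList o m) x′ m (occ-SList-bottom o m))))
    (trans (run-occ o P {s} runs) (trans (cong (occ (suc o) s +_)
        (occ-absent (All.map (λ (p , _) → <⇒≢ p) P-range))) (+-identityʳ _)))

  principal-occ-top : occ (suc (m + o)) v ≡ occ (suc (m + o)) s + Σ[ x′ ] m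
  principal-occ-top = trans (sym (+-identityʳ _)) (trans
    (cong (occ (suc (m + o)) v +_) (sym (occ-absent
        (All.map (λ (_ , q) → ≢-sym (<⇒≢ (≤-trans q (≤-reflexive (+-suc m o))))) P-range))))
    (trans (run-occ (m + o) P {s} runs) (cong (occ (suc (m + o)) s +_)
        (occ-program (SList o m) x′ m (occ-SList-top o m)))))

  principal-occ-outside : ∀ y → (∀ {i} → Range (suc o) (m + suc o) i → suc y ≢ i × y ≢ i) →
                          occ (suc y) v ≡ occ (suc y) s
  principal-occ-outside y out = begin
    occ (suc y) v                 ≡⟨ +-identityʳ _ ⟨
    occ (suc y) v + 0             ≡⟨ cong (occ (suc y) v +_) (occ-absent (All.map (λ r → proj₁ (out r)) P-range)) ⟨
    occ (suc y) v + occ (suc y) P ≡⟨ run-occ y P {s} runs ⟩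
    occ (suc y) s + occ y P       ≡⟨ cong (occ (suc y) s +_) (occ-absent (All.map (λ r → proj₂ (out r)) P-range)) ⟩
    occ (suc y) s + 0             ≡⟨ +-identityʳ _ ⟩
    occ (suc y) s                 ∎
    where open ≡-Reasoning

-- The source of K(c) and the parameters of middle components

srcK-suc : ∀ n c → srcK (suc n) c ≡ srcK n c ++ pw (c (suc n)) (desc 1 (suc n))
srcK-suc n c = begin
  concatMap f (map suc (upTo (suc n)))       ≡⟨ cong (λ ks → concatMap f (map suc ks)) (upTo-∷ʳ n) ⟨
  concatMap f (map suc (upTo n ∷ʳ n))        ≡⟨ cong (concatMap f) (map-++ suc (upTo n) (n ∷ [])) ⟩
  concatMap f (map suc (upTo n) ++ suc n ∷ []) ≡⟨ concatMap-++ f (map suc (upTo n)) (suc n ∷ []) ⟩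
  srcK n c ++ (f (suc n) ++ [])              ≡⟨ cong (srcK n c ++_) (++-identityʳ (f (suc n))) ⟩
  srcK n c ++ f (suc n)                      ≡⟨ cong (λ w → srcK n c ++ pw (c (suc n)) w) (column-desc (suc n)) ⟩
  srcK n c ++ pw (c (suc n)) (desc 1 (suc n)) ∎
  where
    open ≡-Reasoning
    f : ℕ → Word
    f k = pw (c k) (column k)

sig-srcK-above : ∀ {i} n c → n < i → sig i (srcK n c) ≡ (0 , 0)
sig-srcK-above zero    c h = refl
sig-srcK-above {i} (suc n) c h rewrite srcK-suc n c =
  sig-++ (srcK n c) _ (sig-srcK-above n c (<⇒≤ h))
      (sig-pw-0 (c (suc n)) _ (sig-desc-above 1 (suc n) (≤-trans (s≤s (≤-reflexive (+-comm n 1))) h)))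

sig-srcK : ∀ {i} n c → 1 ≤ i → i ≤ n → sig i (srcK n c) ≡ (c i , 0)
sig-srcK zero    c 1≤i i≤ = contradiction 1≤i (<⇒≱ (s≤s i≤))
sig-srcK {i} (suc n) c 1≤i i≤ rewrite srcK-suc n c with m≤n⇒m<n∨m≡n i≤
... | inj₁ i<  = trans (sig-++ (srcK n c) _ (sig-srcK n c 1≤i (s≤s⁻¹ i<)) (sig-pw-0 (c (suc n)) _
        (sig-desc-inside 1 (suc n) 1≤i (s≤s (≤-trans i< (≤-reflexive (+-comm 1 n)))))))
            (cong (_, 0) (+-identityʳ _))
... | inj₂ refl = sig-++ (srcK n c) _ (sig-srcK-above n c ≤-refl) (sig-pw-1 (c (suc n)) _
        (subst (λ a → sig a (desc 1 (suc n)) ≡ (1 , 0)) (+-comm n 1) (sig-desc-end 1 n)))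

sig-IsParam : ∀ o m {x s} c → IsSource (Colours (suc o) (o + m)) x s → IsParam o m s c →
              ∀ {i} → Range (suc o) (m + suc o) i → sig i s ≡ (c i , 0)
sig-IsParam o m c (_ , src) param {i} (o<i , i<) =
  cong₂ _,_ (PathLen-φ (param i r)) (ε-source (λ u → src u i r))
  where
    r : Colours (suc o) (o + m) i
    r = o<i , ≤-trans (s≤s⁻¹ (≤-trans i< (≤-reflexive (+-suc m o)))) (≤-reflexive (+-comm m o))

-- A lowest column of an upper crystal has lost the letter 1, so the middle colours see its full
-- height: height `1 + t` yields largest letter `2 + t`.
upper-middle : ∀ {m t y} d x → t < m →
  longest 1 (suc m) ⊢ y ≈ (cols (desc 1) d (suc m) ++ cols (lowest 0 (suc m)) x (suc m)) →
  φ (2 + t) (climb (longest 2 m) y) ≡ d (2 + t) + x (1 + t)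
upper-middle {m} {t} d x t<m y≈ =
  φ-source {t} {0} {suc m} {d} {x} (λ k → k) (suc t) t t<m z≤n (s≤s t<m) (+-comm (suc t) 1) (λ h → h)
      (m<n⇒m<1+n t<m) refl suc-injective
    (≈-tail 1 m (trans y≈ (cong (λ w → trace (longest 1 (suc m)) (cols (desc 1) d (suc m) ++ w))
      (cols-cong (lowest 0 (suc m)) final x (suc m)
          (λ k _ → cong (λ a → desc a (suc k)) (sym (+-suc (m ∸ k) 1)))))))
  where open Middle m [] (λ _ → refl)

inert : ∀ m {i} → Range 2 (m + 2) i → sig i (3 + m ∷ []) ≡ (0 , 0)
inert m {i} (_ , i<) = sig-∷ i [] refl (skip (≢-sym (<⇒≢ (m<n⇒m<1+n i<′))) (≢-sym (<⇒≢ (s≤s i<′))))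
  where
    i<′ : i < 2 + m
    i<′ = ≤-trans i< (≤-reflexive (+-comm m 2))

lowest-split : ∀ m r k → k ≤ suc m → r ≡ suc m ∸ k + 2 →
               desc r (suc k) ≡ Middle.final m (3 + m ∷ []) (inert m) k
lowest-split m r k k≤ refl = cong (_∷ desc r k)
  (trans (sym (+-assoc k (suc m ∸ k) 2)) (trans (cong (_+ 2) (m+[n∸m]≡n k≤)) (+-comm (suc m) 2)))

-- A lowest column here starts with the invisible letter m + 3, hence `pred`; an untouched column
-- starts from the letter 2, so height `1 + t` already reaches `2 + t`.
lower-middle : ∀ {m t y} d x → t < m →
  longest 2 (suc m) ⊢ y ≈ (cols (desc 2) d (suc m) ++ cols (lowest 1 (suc m)) x (suc m)) →
  φ (2 + t) (climb (longest 2 m) y) ≡ d (1 + t) + x (2 + t)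
lower-middle {m} {t} d x t<m y≈ =
  φ-source {t} {1} {suc m} {d} {x} pred t (suc t) t<m ≤-refl (m<n⇒m<1+n t<m) (+-comm t 2) <⇒≤ (s≤s t<m) refl
      (λ h → h)
    (≈-init 2 m (trans y≈ (cong (λ w → trace (longest 2 (suc m)) (cols (desc 2) d (suc m) ++ w))
      (cols-cong (lowest 1 (suc m)) (λ k → final (pred k)) x (suc m)
          (λ k k< → lowest-split m _ k (<⇒≤ k<) (cong (_+ 2) (sym (+-∸-assoc 1 (s≤s⁻¹ k<)))))))))
  where open Middle m (3 + m ∷ []) (inert m)

whole-middle : ∀ {m t y} d x → t < m →
  longest 1 (2 + m) ⊢ y ≈ (cols (desc 1) d (2 + m) ++ cols (lowest 0 (2 + m)) x (2 + m)) →
  φ (2 + t) (climb (longest 2 m) y) ≡ d (2 + t) + x (2 + t)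
whole-middle {m} {t} d x t<m y≈ =
  φ-source {t} {0} {2 + m} {d} {x} pred (suc t) (suc t) t<m z≤n (s≤s (m<n⇒m<1+n t<m)) (+-comm (suc t) 1) s≤s⁻¹
      (s≤s (m<n⇒m<1+n t<m)) refl (λ h → h)
    (≈-tail 1 m (≈-init 1 (suc m) (trans y≈ (cong (λ w → trace (longest 1 (2 + m)) (cols (desc 1) d (2 + m) ++ w))
      (cols-cong (lowest 0 (2 + m)) (λ k → final (pred k)) x (2 + m)
          (λ k k< → lowest-split m _ k (s≤s⁻¹ k<) (sym (+-suc (suc m ∸ k) 1))))))))
  where open Middle m (3 + m ∷ []) (inert m)

-- From constant differences and equal sums to the deviations

Σ-mono-< : ∀ {A B} m → (∀ k → k ≤ m → A (suc k) < B (suc k)) → Σ[ A ] (suc m) < Σ[ B ] (suc m)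
Σ-mono-< zero    h = h 0 z≤n
Σ-mono-< (suc m) h = +-mono-< (Σ-mono-< m (λ k k≤m → h k (m≤n⇒m≤1+n k≤m))) (h (suc m) ≤-refl)

Parallel : (A B : ℕ → ℕ) → ℕ → Set
Parallel A B m = ∀ {t} → t < m → A (1 + t) + B (2 + t) ≡ A (2 + t) + B (1 + t)

Parallel-sym : ∀ {A B m} → Parallel A B m → Parallel B A m
Parallel-sym {A} {B} h {t} t<m = trans (+-comm (B (1 + t)) _) (trans (sym (h t<m)) (+-comm (A (1 + t)) _))

Parallel-≡ : ∀ {A B m} → Parallel A B m → A 1 ≡ B 1 → ∀ k → k ≤ m → A (suc k) ≡ B (suc k)
Parallel-≡ h eq zero    _  = eq
Parallel-≡ {A} {B} h eq (suc k) k<m = sym (+-cancelˡ-≡ (A (suc k)) (B (2 + k)) (A (2 + k))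
  (trans (h k<m) (trans (cong (λ a → A (2 + k) + a) (sym (Parallel-≡ {A} {B} h eq k (<⇒≤ k<m))))
      (+-comm (A (2 + k)) _))))

Parallel-< : ∀ {A B m} → Parallel A B m → A 1 < B 1 → ∀ k → k ≤ m → A (suc k) < B (suc k)
Parallel-< h lt zero    _   = lt
Parallel-< {A} {B} h lt (suc k) k<m = ≰⇒> (λ le →
  <⇒≢ (+-mono-<-≤ (Parallel-< {A} {B} h lt k (<⇒≤ k<m)) le)
      (trans (h k<m) (+-comm (A (2 + k)) (B (1 + k)))))

-- The difference of `A` and `B` is constant, so a strict inequality at index 1 would spread to all
-- indices and to the sums.
Parallel-Σ : ∀ {A B m} → Parallel A B m → Σ[ A ] (suc m) ≡ Σ[ B ] (suc m) → ∀ k → k ≤ m → A (suc k) ≡ B (suc k)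
Parallel-Σ {A} {B} {m} h eq with <-cmp (A 1) (B 1)
... | tri< lt _ _ = contradiction eq (<⇒≢ (Σ-mono-< m (Parallel-< {A} {B} h lt)))
... | tri≈ _ e _  = Parallel-≡ {A} {B} h e
... | tri> _ _ gt = contradiction (sym eq) (<⇒≢ (Σ-mono-< m (Parallel-< {B} {A} (Parallel-sym {A} {B} h) gt)))

Σ-+ : ∀ A B m → Σ[ (λ k → A k + B k) ] m ≡ Σ[ A ] m + Σ[ B ] m
Σ-+ A B zero    = refl
Σ-+ A B (suc m) = trans (cong (_+ (A (suc m) + B (suc m))) (Σ-+ A B m))
    (interchange (Σ[ A ] m) (Σ[ B ] m) (A (suc m)) (B (suc m)))

box-+ : ∀ {x c r e} → x ≤ c → e ≡ (c ∸ x) + r → x + e ≡ c + r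
box-+ {x} {c} {r} x≤c refl = trans (sym (+-assoc x (c ∸ x) r)) (cong (_+ r) (m+[n∸m]≡n x≤c))

-- `E` is the parameter of the middle component shared by `v` and `w`, `C` that of the hearts.
-- Eliminating both, together with `cU` and `cD`, gives (q - g) + (p₁ - h₁) = (q₁ - g₁) + (p - h).
cancel-parameters : ∀ {cU cD C E p h q g p₁ h₁ q₁ g₁} →
  p + E ≡ cU + p₁ → h + C ≡ cU + h₁ → q + E ≡ cD + q₁ → g + C ≡ cD + g₁ →
  (q + p₁) + (g₁ + h) ≡ (q₁ + p) + (g + h₁)
cancel-parameters {cU} {cD} {C} {E} {p} {h} {q} {g} {p₁} {h₁} {q₁} {g₁} eq₁ eq₂ eq₃ eq₄ =
  +-cancelʳ-≡ ((cU + cD) + (C + E)) _ _ (begin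
    ((q + p₁) + (g₁ + h)) + ((cU + cD) + (C + E))       ≡⟨ shuffle₁ q p₁ g₁ h cU cD C E ⟩
    ((q + E) + (cU + p₁)) + ((h + C) + (cD + g₁))       ≡⟨ cong₂ _+_ (cong₂ _+_ eq₃ (sym eq₁))
        (cong₂ _+_ eq₂ (sym eq₄)) ⟩
    ((cD + q₁) + (p + E)) + ((cU + h₁) + (g + C))       ≡⟨ shuffle₂ q₁ p g h₁ cU cD C E ⟩
    ((q₁ + p) + (g + h₁)) + ((cU + cD) + (C + E))       ∎)
  where
    open ≡-Reasoning
    shuffle₁ : ∀ q p₁ g₁ h cU cD C E → ((q + p₁) + (g₁ + h)) + ((cU + cD) + (C + E)) ≡
               ((q + E) + (cU + p₁)) + ((h + C) + (cD + g₁))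
    shuffle₁ = solve-∀
    shuffle₂ : ∀ q₁ p g h₁ cU cD C E → ((cD + q₁) + (p + E)) + ((cU + h₁) + (g + C)) ≡
               ((q₁ + p) + (g + h₁)) + ((cU + cD) + (C + E))
    shuffle₂ = solve-∀

-- ones and tops count the letters 1 and n + 1; A, B, P, H, Q, G are the sums of the
-- coordinates a, b, p, h↑, q, h↓.
balance : ∀ {A B P H Q G ones tops onesA onesB onesU onesV topsB topsD topsV} →
  onesA + A ≡ ones → onesB + B ≡ ones → onesV + P ≡ onesU → onesA + H ≡ onesU → onesV ≡ onesB →
  topsV ≡ tops + A → topsB ≡ tops + B → topsV ≡ topsD + Q → topsB ≡ topsD + G →
  Q + P ≡ G + H
balance {A} {B} {P} {H} {Q} {G} {ones} {tops} {onesA} {onesB} {onesU} {onesV} {topsB} {topsD} {topsV} a b p h v ta tb tq tg =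
  +-cancelʳ-≡ (((onesA + onesB) + (tops + topsD)) + (A + B)) _ _ (begin
    (Q + P) + (((onesA + onesB) + (tops + topsD)) + (A + B))    ≡⟨ shuffle₁ A B P Q onesA onesB tops topsD ⟩
    ((topsD + Q) + (onesB + P)) + ((onesA + A) + (tops + B))    ≡⟨ cong₂ _+_
        (cong₂ _+_ (trans (sym tq) ta) onesBP) (cong₂ _+_ (trans a (sym b)) (trans (sym tb) tg)) ⟩
    ((tops + A) + (onesA + H)) + ((onesB + B) + (topsD + G))    ≡⟨ shuffle₂ A B G H onesA onesB tops topsD ⟩
    (G + H) + (((onesA + onesB) + (tops + topsD)) + (A + B))    ∎)
  where
    open ≡-Reasoning
    onesBP : onesB + P ≡ onesA + H
    onesBP = trans (cong (_+ P) (sym v)) (trans p (sym h))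
    shuffle₁ : ∀ A B P Q oA oB t tD → (Q + P) + (((oA + oB) + (t + tD)) + (A + B)) ≡
               ((tD + Q) + (oB + P)) + ((oA + A) + (t + B))
    shuffle₁ = solve-∀
    shuffle₂ : ∀ A B G H oA oB t tD → ((t + A) + (oA + H)) + ((oB + B) + (tD + G)) ≡
               (G + H) + (((oA + oB) + (t + tD)) + (A + B))
    shuffle₂ = solve-∀

open import Data.Integer using (ℤ; +_; _-_; -_)
import Data.Integer.Properties as ℤ
import Data.Integer.Tactic.RingSolver as ℤ-Solver

difference : ∀ {q p g h} → q + p ≡ g + h → (+ q) - (+ g) ≡ - ((+ p) - (+ h))
difference {q} {p} {g} {h} eq = begin
  (+ q) - (+ g)                               ≡⟨ expand (+ q) (+ p) (+ g) ⟩
  ((+ q) ℤ.+ (+ p)) - ((+ g) ℤ.+ (+ p))       ≡⟨ cong (λ z → z - ((+ g) ℤ.+ (+ p)))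
      (trans (sym (ℤ.pos-+ q p)) (trans (cong +_ eq) (ℤ.pos-+ g h))) ⟩
  ((+ g) ℤ.+ (+ h)) - ((+ g) ℤ.+ (+ p))       ≡⟨ collapse (+ g) (+ h) (+ p) ⟩
  - ((+ p) - (+ h))                           ∎
  where
    open ≡-Reasoning
    import Data.Integer as ℤ
    expand : ∀ x y z → x - z ≡ (x ℤ.+ y) - (z ℤ.+ y)
    expand = ℤ-Solver.solve-∀
    collapse : ∀ x y z → (x ℤ.+ y) - (x ℤ.+ z) ≡ - (z - y)
    collapse = ℤ-Solver.solve-∀

theorem2 : (n : ℕ) → 2 ≤ n → (c : ℕ → ℕ) →
    (a : ℕ → ℕ) → InBox 1 n c a →
    (πa : Word) → principal 0 n a (srcK n c) ≡ just πa →
    (sU : Word) → IsSource (Colours 1 (n ∸ 1)) πa sU →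
    (cU : ℕ → ℕ) → IsParam 0 (n ∸ 1) sU cU →
    (hU : ℕ → ℕ) → InBox 1 (n ∸ 1) cU hU → principal 0 (n ∸ 1) hU sU ≡ just πa →
    (p : ℕ → ℕ) → InBox 1 (n ∸ 1) cU p →
    (v : Word) → principal 0 (n ∸ 1) p sU ≡ just v →
    (b : ℕ → ℕ) → InBox 1 n c b →
    (πb : Word) → principal 0 n b (srcK n c) ≡ just πb →
    Conn (Colours 2 n) πb v →
    (sD : Word) → IsSource (Colours 2 n) πb sD →
    (cD : ℕ → ℕ) → IsParam 1 (n ∸ 1) sD cD →
    (hD : ℕ → ℕ) → InBox 2 n cD hD → principal 1 (n ∸ 1) hD sD ≡ just πb →
    (q : ℕ → ℕ) → InBox 2 n cD q →
    (w : Word) → principal 1 (n ∸ 1) q sD ≡ just w →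
    Conn (Colours 2 (n ∸ 1)) v w →
    (i : ℕ) → 2 ≤ i → i ≤ n →
    (+ q i) - (+ hD i) ≡ - ((+ p (i ∸ 1)) - (+ hU (i ∸ 1)))
theorem2 (suc (suc m)) (s≤s (s≤s _)) c a a≤ πa πa-eq sU sU-src cU cU-par hU hU≤ hU-eq p p≤ v v-eq
         b b≤ πb πb-eq _ sD sD-src cD cD-par hD hD≤ hD-eq q q≤ w w-eq v∼w (suc (suc i)) (s≤s (s≤s _)) (s≤s (s≤s i≤m)) =
  difference {q (2 + i)} {p (1 + i)} {hD (2 + i)} {hU (1 + i)} (Parallel-Σ {A} {B} {m} parallel sums i i≤m)
  where
    -- A k - B k is the sum of ∇ at k + 1 and Δ at k.
    A B : ℕ → ℕ
    A k = q (1 + k) + p k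
    B k = hD (1 + k) + hU k

    ≤U : ∀ {k} → k < suc m + 1 → k ≤ suc m
    ≤U h = s≤s⁻¹ (≤-trans h (≤-reflexive (+-comm (suc m) 1)))
    ≤D : ∀ {k} → k < suc m + 2 → k ≤ 2 + m
    ≤D h = s≤s⁻¹ (≤-trans h (≤-reflexive (+-comm (suc m) 2)))
    ≤K : ∀ {k} → k < 2 + m + 1 → k ≤ 2 + m
    ≤K h = s≤s⁻¹ (≤-trans h (≤-reflexive (+-comm (2 + m) 1)))

    K-≈ : ∀ {x y} → InBox 1 (2 + m) c x → principal 0 (2 + m) x (srcK (2 + m) c) ≡ just y → _
    K-≈ {x} x≤ = principal-≈ 0 (2 + m) {c} {x} (λ (r , r′) → sig-srcK (2 + m) c r (≤K r′))
        (λ {k} (r , r′) → x≤ k r (≤K r′))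
    U-≈ : ∀ {x y} → InBox 1 (suc m) cU x → principal 0 (suc m) x sU ≡ just y → _
    U-≈ {x} x≤ = principal-≈ 0 (suc m) {cU} {x} (sig-IsParam 0 (suc m) cU sU-src cU-par)
        (λ {k} (r , r′) → x≤ k r (≤U r′))
    D-≈ : ∀ {x y} → InBox 2 (2 + m) cD x → principal 1 (suc m) x sD ≡ just y → _
    D-≈ {x} x≤ = principal-≈ 1 (suc m) {cD} {x} (sig-IsParam 1 (suc m) cD sD-src cD-par)
        (λ {k} (r , r′) → x≤ k r (≤D r′))

    same-source : climb (longest 2 m) v ≡ climb (longest 2 m) w
    same-source = Conn-climb {2} {m} (λ (r , r′) → r , ≤-trans (s≤s r′) (≤-reflexive (+-comm 2 m))) v∼w

    parallel : Parallel A B m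
    parallel {t} t<m = cancel-parameters
      {cU (2 + t)} {cD (2 + t)} {c (2 + t)} {φ (2 + t) (climb (longest 2 m) v)}
      {p (2 + t)} {hU (2 + t)} {q (2 + t)} {hD (2 + t)} {p (1 + t)} {hU (1 + t)} {q (3 + t)} {hD (3 + t)}
      (box-+ (p≤ (2 + t) (s≤s z≤n) (s≤s t<m)) (upper-middle (λ k → cU k ∸ p k) p t<m (U-≈ p≤ v-eq)))
      -- The heart lies in Π and in Π↑[a]; `K-param` gives its middle parameter from the first
      -- description, `upper-middle` from the second.
      (box-+ (hU≤ (2 + t) (s≤s z≤n) (s≤s t<m))
          (trans (sym (K-param a≤ πa-eq)) (upper-middle (λ k → cU k ∸ hU k) hU t<m (U-≈ hU≤ hU-eq))))
      (box-+ (q≤ (2 + t) (s≤s (s≤s z≤n)) t≤) (trans (cong (φ (2 + t)) same-source)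
          (lower-middle (λ k → cD (1 + k) ∸ q (1 + k)) (λ k → q (1 + k)) t<m (D-≈ q≤ w-eq))))
      (box-+ (hD≤ (2 + t) (s≤s (s≤s z≤n)) t≤)
          (trans (sym (K-param b≤ πb-eq)) (lower-middle (λ k → cD (1 + k) ∸ hD (1 + k)) (λ k → hD (1 + k)) t<m
              (D-≈ hD≤ hD-eq))))
      where
        t≤ : 2 + t ≤ 2 + m
        t≤ = s≤s (s≤s (<⇒≤ t<m))
        K-param : ∀ {x y} → InBox 1 (2 + m) c x → principal 0 (2 + m) x (srcK (2 + m) c) ≡ just y →
                  φ (2 + t) (climb (longest 2 m) y) ≡ c (2 + t)
        K-param {x} x≤ h = trans (whole-middle (λ k → c k ∸ x k) x t<m (K-≈ x≤ h))
            (m∸n+n≡m (x≤ (2 + t) (s≤s z≤n) t≤))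

    sums : Σ[ A ] (suc m) ≡ Σ[ B ] (suc m)
    sums = trans (Σ-+ (λ k → q (1 + k)) p (suc m)) (trans
      (balance {Σ[ a ] (2 + m)} {Σ[ b ] (2 + m)} {Σ[ p ] (suc m)} {Σ[ hU ] (suc m)}
               {Σ[ (λ k → q (1 + k)) ] (suc m)} {Σ[ (λ k → hD (1 + k)) ] (suc m)}
               {occ 1 (srcK (2 + m) c)} {occ (3 + m) (srcK (2 + m) c)}
               {occ 1 πa} {occ 1 πb} {occ 1 sU} {occ 1 v} {occ (3 + m) πb} {occ (3 + m) sD} {occ (3 + m) v}
        (principal-occ-bottom 0 (2 + m) πa-eq) (principal-occ-bottom 0 (2 + m) πb-eq)
        (principal-occ-bottom 0 (suc m) v-eq) (principal-occ-bottom 0 (suc m) hU-eq)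
        -- Middle and lower colours are at least 2, so `v`, `w`, `sD` and πb have equally many
        -- letters 1.
        (trans (Conn-occ {0} (λ (r , _) → (λ e → <⇒≢ r e) , (λ { refl → contradiction r (λ ()) })) v∼w)
               (trans (principal-occ-outside 1 (suc m) w-eq 0 below)
                   (sym (principal-occ-outside 1 (suc m) hD-eq 0 below))))
        -- Upper colours do not reach the letter n + 1, so its count agrees at `v`, `sU` and πa.
        (trans (tops-eq (principal-occ-outside 0 (suc m) v-eq (2 + m) above)
            (principal-occ-outside 0 (suc m) hU-eq (2 + m) above))
               (top₀ πa-eq))
        (top₀ πb-eq)
        (trans (Conn-occ {2 + m} (λ (_ , r) → (λ e → <⇒≢ (s≤s (m≤n⇒m≤1+n r)) (sym e)) ,
            (λ e → <⇒≢ (s≤s r) (sym e))) v∼w) (top₁ w-eq))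
        (top₁ hD-eq))
      (sym (Σ-+ (λ k → hD (1 + k)) hU (suc m))))
      where
        below : ∀ {k} → Range 2 (suc m + 2) k → 1 ≢ k × 0 ≢ k
        below (r , _) = <⇒≢ r , <⇒≢ (<⇒≤ r)
        above : ∀ {k} → Range 1 (suc m + 1) k → 3 + m ≢ k × 2 + m ≢ k
        above (_ , r) = ≢-sym (<⇒≢ (m<n⇒m<1+n (s≤s (≤U r)))) , ≢-sym (<⇒≢ (s≤s (≤U r)))
        tops-eq : ∀ {x y z : ℕ} → x ≡ z → y ≡ z → x ≡ y
        tops-eq e e′ = trans e (sym e′)
        top₀ : ∀ {x y} → principal 0 (2 + m) x (srcK (2 + m) c) ≡ just y →
               occ (3 + m) y ≡ occ (3 + m) (srcK (2 + m) c) + Σ[ x ] (2 + m)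
        top₀ {x} {y} h = subst (λ z → occ (3 + z) y ≡ occ (3 + z) (srcK (2 + m) c) + Σ[ x ] (2 + m))
            (+-identityʳ m) (principal-occ-top 0 (2 + m) h)
        top₁ : ∀ {x y} → principal 1 (suc m) x sD ≡ just y →
               occ (3 + m) y ≡ occ (3 + m) sD + Σ[ (λ k → x (1 + k)) ] (suc m)
        top₁ {x} {y} h = subst (λ z → occ z y ≡ occ z sD + Σ[ (λ k → x (1 + k)) ] (suc m))
            (cong (λ z → 2 + z) (+-comm m 1)) (principal-occ-top 1 (suc m) h)
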